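{- Let $n\ge 5$ and let $P_{\mathcal G}(n)=\mathrm{conv}\{(x,y)\in\mathbb R^2:\ \exists G \text{ a graph of order } n \text{ with } \alpha(G)=x,\ F(G)=y\}$. Then the polytope $P_{\mathcal G}(n)$ has exactly $n$ facets, defined by the inequalities \[ y\ge (2^k-1)x+2^k(1-k)+n,\quad k=1,2,\dots,n-1, \] and \[ y\le \frac{2^n-n-1}{n-1}(x-1)+n+1. \]
   Context: Graphs are finite, simple, undirected. $\alpha(G)$ is the stability number of $G$ and $F(G)$ (the Fibonacci index) is the number of stable sets of $G$ including the empty set. conv denotes convex hull.
   Formalization: The points (x,y) and the convex weights are rational instead of real; "exactly n facets" is stated as equality with the intersection of the n half-planes plus two distinct points (α(G),F(G)) on each boundary line, leaving the obvious distinctness of the lines unstated. -}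

module Defs where

open import Data.Bool using (Bool; true; false)
open import Data.Nat as ℕ using (ℕ; zero; suc; _∸_; _^_; _⊔_)
import Data.Nat.Properties as ℕP
open import Data.Integer as ℤ using (ℤ; +_)
open import Data.Rational as ℚ using (ℚ; _/_)
open import Data.Fin using (Fin)
open import Data.Fin.Subset using (Subset; _∈_; ∣_∣)
open import Data.Fin.Subset.Properties using (_∈?_)
open import Data.Fin.Properties using (all?)
open import Data.Vec using ([]; _∷_)
open import Data.List using (List; []; _∷_; _++_; map; filter; length; foldr)
open import Data.Product using (Σ; _×_; _,_; proj₁; proj₂)
open import Relation.Binary.PropositionalEquality using (_≡_; _≢_)
open import Relation.Nullary using (Dec; yes; no)
open import Relation.Nullary.Decidable using (_→-dec_)
open import Data.Bool.Properties using () renaming (_≟_ to _≟ᵇ_)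

record Graph (n : ℕ) : Set where
  field
    adj   : Fin n → Fin n → Bool
    sym   : ∀ i j → adj i j ≡ adj j i
    irref : ∀ i → adj i i ≡ false
open Graph public

Stable : ∀ {n} → Graph n → Subset n → Set
Stable G S = ∀ i j → i ∈ S → j ∈ S → adj G i j ≡ false

stable? : ∀ {n} (G : Graph n) (S : Subset n) → Dec (Stable G S)
stable? G S = all? λ i → all? λ j →
  (i ∈? S) →-dec ((j ∈? S) →-dec (adj G i j ≟ᵇ false))

allSubsets : (n : ℕ) → List (Subset n)
allSubsets zero    = [] ∷ []
allSubsets (suc n) = map (false ∷_) (allSubsets n) ++ map (true ∷_) (allSubsets n)

stableSets : ∀ {n} → Graph n → List (Subset n)
stableSets {n} G = filter (stable? G) (allSubsets n)

F : ∀ {n} → Graph n → ℕ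
F G = length (stableSets G)

α : ∀ {n} → Graph n → ℕ
α G = foldr _⊔_ 0 (map ∣_∣ (stableSets G))

ℕ→ℚ : ℕ → ℚ
ℕ→ℚ m = (+ m) / 1

ℤ→ℚ : ℤ → ℚ
ℤ→ℚ z = z / 1

pt : ∀ {n} → Graph n → ℚ × ℚ
pt G = ℕ→ℚ (α G) , ℕ→ℚ (F G)

InConvHull : (n : ℕ) → ℚ × ℚ → Set
InConvHull n (x , y) =
  Σ (List (ℚ × Graph n)) λ ws →
    (∀ {w G} → (w , G) Data.List.Membership.Propositional.∈ ws → ℚ.0ℚ ℚ.≤ w) ×
    (foldr (λ p s → proj₁ p ℚ.+ s) ℚ.0ℚ ws ≡ ℚ.1ℚ) ×
    (foldr (λ p s → proj₁ p ℚ.* proj₁ (pt (proj₂ p)) ℚ.+ s) ℚ.0ℚ ws ≡ x) ×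
    (foldr (λ p s → proj₁ p ℚ.* proj₂ (pt (proj₂ p)) ℚ.+ s) ℚ.0ℚ ws ≡ y)
  where import Data.List.Membership.Propositional

lowerRHS : (n k : ℕ) → ℚ → ℚ
lowerRHS n k x =
  ℕ→ℚ (2 ^ k ∸ 1) ℚ.* x
    ℚ.+ ℤ→ℚ ((+ (2 ^ k)) ℤ.* ((+ 1) ℤ.- (+ k)))
    ℚ.+ ℕ→ℚ n

upperRHS : (n : ℕ) → 2 ℕ.≤ n → ℚ → ℚ
upperRHS n 2≤n x =
  ((+ (2 ^ n ∸ n ∸ 1)) / (n ∸ 1)) {{ℕ.>-nonZero (ℕP.m<n⇒0<n∸m 2≤n)}}
    ℚ.* (x ℚ.- ℚ.1ℚ) ℚ.+ ℕ→ℚ (n ℕ.+ 1)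

5≤⇒2≤ : ∀ {n} → 5 ℕ.≤ n → 2 ℕ.≤ n
5≤⇒2≤ h = ℕP.≤-trans (ℕ.s≤s (ℕ.s≤s ℕ.z≤n)) h

InPolygon : (n : ℕ) → 5 ℕ.≤ n → ℚ × ℚ → Set
InPolygon n h (x , y) =
  (∀ k → 1 ℕ.≤ k → k ℕ.≤ n ∸ 1 → lowerRHS n k x ℚ.≤ y) ×
  (y ℚ.≤ upperRHS n (5≤⇒2≤ h) x)

-- In the plane, the line { y = f(x) } supports a facet (an edge) of the
-- polygon iff it contains two distinct points of the polygon; since the
-- polygon's vertices are points (α(G),F(G)), we ask for two graphs.
FacetLine : (n : ℕ) → (ℚ → ℚ) → Set
FacetLine n f =
  Σ (Graph n) λ G₁ → Σ (Graph n) λ G₂ →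
    (pt G₁ ≢ pt G₂) ×
    (proj₂ (pt G₁) ≡ f (proj₁ (pt G₁))) ×
    (proj₂ (pt G₂) ≡ f (proj₁ (pt G₂)))

{-# OPTIONS --safe #-}
module Submission where

-- Branching on whether a vertex v is used gives F(G) = F(G - v) + F(G - N[v]), with
-- α(G - N[v]) ≤ α(G) - 1.  Induction along this recursion shows F ≥ 2^α + n - α, which by
-- convexity of 2^x lies above every lower line, with equality for the join of α independent
-- vertices and a clique.  It also bounds F by a function of n and α alone, which for n ≥ 5 stays
-- below the line through (1, n + 1) and (n, 2^n), except at n = 5, α = 2, where a finer count is
-- needed.  Conversely, a point of the polygon lies on a vertical segment between a chord of the
-- lower boundary and the upper edge, so it is a convex combination of four extremal points.

-- The drop in α alone is too weak for the upper line: branching would then give the number of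
-- subsets with at most α elements, 22 for n = 6 and α = 2, where the line has height 18.4. The
-- missing gain comes from a dichotomy on the branching vertex v. If v has a neighbour, then G -
-- N[v] loses a second vertex. If v is isolated, then G - v equals G - N[v], so both summands have
-- the smaller stability number. The resulting recursion gives 18 in this example.

module StableSets where

  open import Data.Bool as 𝔹 using (Bool; true; false; not; _∧_; if_then_else_; b≤b; f≤t)
  import Data.Bool.Properties as 𝔹P
  open import Data.Fin using (Fin; zero; suc)
  open import Data.Fin.Subset using (Subset; _∈_; ∣_∣)
  open import Data.List using (List; []; _∷_; _++_; map; filter; length; foldr; tabulate; allFin)
  open import Data.List.Properties
  open import Data.List.Relation.Unary.All as All using (All; []; _∷_)
  import Data.List.Relation.Unary.All.Properties as AllP
  open import Data.Nat
  open import Data.Nat.Properties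
  open import Data.Nat.Tactic.RingSolver using (solve-∀)
  open import Data.Product using (Σ; _×_; _,_; proj₁; proj₂)
  open import Data.Sum using (_⊎_; inj₁; inj₂)
  open import Data.Vec.Base using (_∷_; here; there)
  open import Defs using (Graph; module Graph; adj; irref; stable?; allSubsets; stableSets; F; α)
  open import Function using (_∘_)
  open import Relation.Binary.PropositionalEquality
  open import Relation.Nullary using (does; ¬_)
  open import Relation.Nullary.Decidable using (from-yes)
  open import Relation.Unary using (Decidable; _≐_)

  -- A recursive upper bound in terms of order and stability number

  -- bound n a bounds F for n vertices and α ≤ a.  Deleting v and its neighbours costs a unit of
  -- a; the two arguments of ⊔ treat v with at least one neighbour, and v isolated.
  bound : ℕ → ℕ → ℕ
  bound zero          _       = 1
  bound (suc n)       zero    = 1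
  bound (suc zero)    (suc a) = 2
  bound (suc (suc n)) (suc a) = (bound (suc n) (suc a) + bound n a) ⊔ 2 * bound (suc n) a

  1≤bound : ∀ n a → 1 ≤ bound n a
  1≤bound zero          a       = ≤-refl
  1≤bound (suc n)       zero    = ≤-refl
  1≤bound (suc zero)    (suc a) = s≤s z≤n
  1≤bound (suc (suc n)) (suc a) = m≤n⇒m≤n⊔o _ (m≤n⇒m≤n+o _ (1≤bound (suc n) (suc a)))

  bound-stepˡ : ∀ n a → bound n a ≤ bound (suc n) a
  bound-stepˡ zero    zero    = ≤-refl
  bound-stepˡ zero    (suc a) = s≤s z≤n
  bound-stepˡ (suc n) zero    = ≤-refl
  bound-stepˡ (suc n) (suc a) = m≤n⇒m≤n⊔o _ (m≤m+n _ _)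

  bound-stepʳ : ∀ n a → bound n a ≤ bound n (suc a)
  bound-stepʳ zero          a       = ≤-refl
  bound-stepʳ (suc n)       zero    = 1≤bound (suc n) 1
  bound-stepʳ (suc zero)    (suc a) = ≤-refl
  bound-stepʳ (suc (suc n)) (suc a) =
    ⊔-mono-≤ (+-mono-≤ (bound-stepʳ (suc n) (suc a)) (bound-stepʳ n a))
             (*-monoʳ-≤ 2 (bound-stepʳ (suc n) a))

  step⇒mono : (f : ℕ → ℕ) → (∀ k → f k ≤ f (suc k)) → ∀ {j k} → j ≤ k → f j ≤ f k
  step⇒mono f step j≤k = go (≤⇒≤′ j≤k)
    where
    go : ∀ {j k} → j ≤′ k → f j ≤ f k
    go (≤′-reflexive refl) = ≤-refl
    go (≤′-step h)         = ≤-trans (go h) (step _)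

  bound-mono : ∀ {m n a b} → m ≤ n → a ≤ b → bound m a ≤ bound n b
  bound-mono {m} {n} {a} {b} m≤n a≤b =
    ≤-trans (step⇒mono (λ k → bound k a) (λ k → bound-stepˡ k a) m≤n)
            (step⇒mono (bound n) (bound-stepʳ n) a≤b)

  -- In the branching, `n` and `a` belong to G - v, `m` and `b` to G - N[v], and `a ⊔ suc b` is the
  -- stability number of G. A neighbour of v makes `m < n`, which matches the summand of `bound`
  -- that lies two orders lower.
  bound-neighbour : ∀ {n m a b} → m < n → bound n a + bound m b ≤ bound (suc n) (a ⊔ suc b)
  bound-neighbour {suc n} {m} {a} {b} (s≤s m≤n) with a ⊔ suc b | m≤m⊔n a (suc b) | m≤n⊔m a (suc b)
  ... | suc t | a≤ | s≤s b≤t = m≤n⇒m≤n⊔o _ (+-mono-≤ (bound-mono {suc n} ≤-refl a≤) (bound-mono m≤n b≤t))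

  bound-isolated : ∀ n a b → 2 * bound n b ≤ bound (suc n) (a ⊔ suc b)
  bound-isolated zero a b with a ⊔ suc b | m≤n⊔m a (suc b)
  ... | suc t | _ = ≤-refl
  bound-isolated (suc n) a b with a ⊔ suc b | m≤n⊔m a (suc b)
  ... | suc t | s≤s b≤t = m≤n⇒m≤o⊔n _ (*-monoʳ-≤ 2 (bound-mono {suc n} ≤-refl b≤t))

  -- Branching on the vertices of induced subgraphs

  module Counting {V : Set} (indep : V → V → Bool) where

    -- Induced subgraphs are masks p on a fixed list of vertices, so that branching on a vertex is
    -- structural recursion; p ∩ v removes the neighbours of v.
    infixl 7 _∩_
    _∩_ : (V → Bool) → V → V → Bool
    (p ∩ v) w = p w ∧ indep v w

    order stables stability : (V → Bool) → List V → ℕ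
    order p []      = 0
    order p (v ∷ l) = if p v then suc (order p l) else order p l

    stables p []      = 1
    stables p (v ∷ l) = if p v then stables p l + stables (p ∩ v) l else stables p l

    stability p []      = 0
    stability p (v ∷ l) = if p v then stability p l ⊔ suc (stability (p ∩ v) l) else stability p l

    Sub : (p q : V → Bool) → List V → Set
    Sub p q = All λ w → p w 𝔹.≤ q w

    ∧-monoˡ : ∀ {x y} z → x 𝔹.≤ y → (x ∧ z) 𝔹.≤ (y ∧ z)
    ∧-monoˡ z b≤b = b≤b
    ∧-monoˡ z f≤t = 𝔹P.≤-minimum z

    ∧-lower : ∀ x y → (x ∧ y) 𝔹.≤ x
    ∧-lower true  y = 𝔹P.≤-maximum y
    ∧-lower false y = b≤b

    ∩-sub : ∀ p v l → Sub (p ∩ v) p l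
    ∩-sub p v = All.universal λ w → ∧-lower (p w) (indep v w)

    ∩-mono : ∀ {p q l} v → Sub p q l → Sub (p ∩ v) (q ∩ v) l
    ∩-mono v = All.map λ {w} → ∧-monoˡ (indep v w)

    order-mono : ∀ {p q} l → Sub p q l → order p l ≤ order q l
    order-mono []      []      = z≤n
    order-mono {p} {q} (v ∷ l) (h ∷ s) with p v | q v | h
    ... | true  | _ | b≤b = s≤s (order-mono l s)
    ... | false | _ | b≤b = order-mono l s
    ... | false | _ | f≤t = m≤n⇒m≤1+n (order-mono l s)

    stability-mono : ∀ {p q} l → Sub p q l → stability p l ≤ stability q l
    stability-mono []      []      = z≤n
    stability-mono {p} {q} (v ∷ l) (h ∷ s) with p v | q v | h
    ... | true  | _ | b≤b = ⊔-mono-≤ (stability-mono l s) (s≤s (stability-mono l (∩-mono v s)))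
    ... | false | _ | b≤b = stability-mono l s
    ... | false | _ | f≤t = m≤n⇒m≤n⊔o _ (stability-mono l s)

    stables-mono : ∀ {p q} l → Sub p q l → stables p l ≤ stables q l
    stables-mono []      []      = ≤-refl
    stables-mono {p} {q} (v ∷ l) (h ∷ s) with p v | q v | h
    ... | true  | _ | b≤b = +-mono-≤ (stables-mono l s) (stables-mono l (∩-mono v s))
    ... | false | _ | b≤b = stables-mono l s
    ... | false | _ | f≤t = m≤n⇒m≤n+o _ (stables-mono l s)

    -- Applied to `p ∩ v` inside `p`, this is the dichotomy on v: either a neighbour of v leaves the
    -- mask, or the two masks agree on `l` and v is isolated.
    order-<⊎sub : ∀ {p q} l → Sub p q l → order p l < order q l ⊎ Sub q p l
    order-<⊎sub []      []      = inj₂ []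
    order-<⊎sub {p} {q} (v ∷ l) (h ∷ s) with p v in pv | q v in qv | h | order-<⊎sub l s
    ... | true  | _ | b≤b | inj₁ lt = inj₁ (s≤s lt)
    ... | false | _ | b≤b | inj₁ lt = inj₁ lt
    ... | false | _ | f≤t | _       = inj₁ (s≤s (order-mono l s))
    ... | _     | _ | b≤b | inj₂ s′ = inj₂ (𝔹P.≤-reflexive (trans qv (sym pv)) ∷ s′)

    1≤stables : ∀ p l → 1 ≤ stables p l
    1≤stables p []      = ≤-refl
    1≤stables p (v ∷ l) with p v
    ... | true  = m≤n⇒m≤n+o _ (1≤stables p l)
    ... | false = 1≤stables p l

    stability≤order : ∀ p l → stability p l ≤ order p l
    stability≤order p []      = z≤n
    stability≤order p (v ∷ l) with p v
    ... | true  = ⊔-lub (m≤n⇒m≤1+n (stability≤order p l))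
                        (s≤s (≤-trans (stability≤order (p ∩ v) l) (order-mono l (∩-sub p v l))))
    ... | false = stability≤order p l

    stables≤bound : ∀ p l → stables p l ≤ bound (order p l) (stability p l)
    stables≤bound p []      = ≤-refl
    stables≤bound p (v ∷ l) with p v
    ... | false = stables≤bound p l
    ... | true with order-<⊎sub l (∩-sub p v l)
    ...   | inj₁ lt = ≤-trans (+-mono-≤ (stables≤bound p l) (stables≤bound (p ∩ v) l)) (bound-neighbour {a = stability p l} lt)
    -- For an isolated v both branches count the same sets, so each is bounded through the smaller
    -- stability number, that of `p ∩ v`.
    ...   | inj₂ s  = begin
      stables p l + stables (p ∩ v) l ≤⟨ +-monoˡ-≤ _ (stables-mono l s) ⟩
      stables (p ∩ v) l + stables (p ∩ v) l ≡⟨ cong (stables (p ∩ v) l +_) (sym (+-identityʳ _)) ⟩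
      2 * stables (p ∩ v) l ≤⟨ *-monoʳ-≤ 2 (stables≤bound (p ∩ v) l) ⟩
      2 * bound (order (p ∩ v) l) (stability (p ∩ v) l) ≤⟨ *-monoʳ-≤ 2 (bound-mono (order-mono l (∩-sub p v l)) ≤-refl) ⟩
      2 * bound (order p l) (stability (p ∩ v) l) ≤⟨ bound-isolated (order p l) (stability p l) (stability (p ∩ v) l) ⟩
      bound (suc (order p l)) (stability p l ⊔ suc (stability (p ∩ v) l)) ∎
      where open ≤-Reasoning

    stables≤bound′ : ∀ p l {m a} → order p l ≤ m → stability p l ≤ a → stables p l ≤ bound m a
    stables≤bound′ p l order≤ stability≤ = ≤-trans (stables≤bound p l) (bound-mono order≤ stability≤)

    _∖_ : (V → Bool) → (V → Bool) → V → Bool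
    (p ∖ q) w = p w ∧ not (q w)

    ∩-∖ : ∀ p q v l → Sub ((p ∩ v) ∖ (q ∩ v)) (p ∖ q) l
    ∩-∖ p q v = All.universal λ w → go (p w) (q w) (indep v w)
      where
      go : ∀ x y z → ((x ∧ z) ∧ not (y ∧ z)) 𝔹.≤ (x ∧ not y)
      go false y     z     = b≤b
      go true  true  false = b≤b
      go true  true  true  = b≤b
      go true  false z     = 𝔹P.≤-maximum _

    -- Putting back one vertex at most doubles the count, because removing it from the sets that
    -- contain it is injective. In the branch through a kept vertex at most as many vertices are
    -- missing, so the same exponent serves both branches.
    stables-delete : ∀ {p q} l → Sub q p l → stables p l ≤ 2 ^ order (p ∖ q) l * stables q l
    stables-delete []      []      = ≤-refl
    stables-delete {p} {q} (v ∷ l) (h ∷ s) with q v | p v | h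
    ... | false | _ | b≤b = stables-delete l s
    ... | false | _ | f≤t = begin
      stables p l + stables (p ∩ v) l   ≤⟨ +-monoʳ-≤ _ (stables-mono l (∩-sub p v l)) ⟩
      stables p l + stables p l         ≤⟨ +-mono-≤ (stables-delete l s) (stables-delete l s) ⟩
      e * stables q l + e * stables q l ≡⟨ lem e (stables q l) ⟩
      2 * e * stables q l               ∎
      where
      open ≤-Reasoning
      e = 2 ^ order (p ∖ q) l
      lem : ∀ e x → e * x + e * x ≡ 2 * e * x
      lem = solve-∀
    ... | true  | _ | b≤b = begin
      stables p l + stables (p ∩ v) l ≤⟨ +-mono-≤ (stables-delete l s) (stables-delete l (∩-mono v s)) ⟩
      e * stables q l + 2 ^ order ((p ∩ v) ∖ (q ∩ v)) l * stables (q ∩ v) l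
        ≤⟨ +-monoʳ-≤ _ (*-monoˡ-≤ (stables (q ∩ v) l) (^-monoʳ-≤ 2 (order-mono l (∩-∖ p q v l)))) ⟩
      e * stables q l + e * stables (q ∩ v) l ≡⟨ sym (*-distribˡ-+ e (stables q l) (stables (q ∩ v) l)) ⟩
      e * (stables q l + stables (q ∩ v) l)   ∎
      where
      open ≤-Reasoning
      e = 2 ^ order (p ∖ q) l

    order-∖ : ∀ {p q} l → Sub q p l → order (p ∖ q) l + order q l ≡ order p l
    order-∖ []      []      = refl
    order-∖ {p} {q} (v ∷ l) (h ∷ s) with q v | p v | h
    ... | false | true  | f≤t = cong suc (order-∖ l s)
    ... | false | false | b≤b = order-∖ l s
    ... | true  | true  | b≤b = trans (+-suc _ _) (cong suc (order-∖ l s))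

    -- bound 5 2 = 13 is too large.  If the vertex v has exactly one neighbour, the three vertices
    -- independent of v form a triangle.
    stables-five : ∀ p l → order p l ≡ 5 → stability p l ≤ 2 → stables p l ≤ 12
    stables-five p (v ∷ l) order≡ stability≤ with p v
    ... | false = stables-five p l order≡ stability≤
    ... | true with suc-injective order≡ | m⊔n≤o⇒m≤o (stability p l) _ stability≤ | s≤s⁻¹ (m⊔n≤o⇒n≤o (stability p l) _ stability≤)
    ...   | order≡4 | stability≤2 | stability′≤1 with order-<⊎sub l (∩-sub p v l)
    -- Here v is isolated and the other vertices have stability number at most 1, so each branch has
    -- at most 5 sets. The second estimate is padded to 7 to reach 12.
    ...     | inj₂ s = +-mono-≤ {y = 5} {v = 7} (≤-trans (stables-mono l s) rest≤5) (m≤n⇒m≤1+n (m≤n⇒m≤1+n rest≤5))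
      where
      rest≤5 : stables (p ∩ v) l ≤ 5
      rest≤5 = stables≤bound′ (p ∩ v) l (≤-trans (order-mono l (∩-sub p v l)) (≤-reflexive order≡4)) stability′≤1
    ...     | inj₁ lt with m≤n⇒m<n∨m≡n (s≤s⁻¹ (subst (order (p ∩ v) l <_) order≡4 lt))
    -- With at least two neighbours the recursion suffices: `bound 4 2` is 9 and `bound 2 1` is 3.
    ...       | inj₁ (s≤s order≤2) = +-mono-≤ (stables≤bound′ p l (≤-reflexive order≡4) stability≤2) (stables≤bound′ (p ∩ v) l order≤2 stability′≤1)
    ...       | inj₂ order≡3 = +-mono-≤ {y = 8} whole≤8 rest≤4
      where
      rest≤4 : stables (p ∩ v) l ≤ 4
      rest≤4 = stables≤bound′ (p ∩ v) l (≤-reflexive order≡3) stability′≤1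
      one : order (p ∖ (p ∩ v)) l ≡ 1
      one = +-cancelʳ-≡ 3 _ _ (trans (cong (order (p ∖ (p ∩ v)) l +_) (sym order≡3)) (trans (order-∖ l (∩-sub p v l)) order≡4))
      whole≤8 : stables p l ≤ 8
      whole≤8 = ≤-trans (stables-delete l (∩-sub p v l))
        (subst (λ e → 2 ^ e * stables (p ∩ v) l ≤ 8) (sym one) (*-monoʳ-≤ 2 rest≤4))

    -- The claim F ≥ 2^α + n - α is written without subtraction. The case split asks whether G - v
    -- already has the stability number of G.
    stables-lower : ∀ p l → 2 ^ stability p l + order p l ≤ stables p l + stability p l
    stables-lower p []      = ≤-refl
    stables-lower p (v ∷ l) with p v
    ... | false = stables-lower p l
    ... | true with ≤-total (stability p l) (suc (stability (p ∩ v) l))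
    -- The stability number is unchanged, and the additional vertex is paid for by at least one
    -- stable set through v.
    ...   | inj₂ b<a rewrite m≥n⇒m⊔n≡m b<a = begin
      2 ^ a + suc (order p l)               ≡⟨ +-suc _ _ ⟩
      1 + (2 ^ a + order p l)               ≤⟨ +-mono-≤ (1≤stables (p ∩ v) l) (stables-lower p l) ⟩
      stables (p ∩ v) l + (stables p l + a) ≡⟨ lem (stables (p ∩ v) l) (stables p l) a ⟩
      stables p l + stables (p ∩ v) l + a   ∎
      where
      open ≤-Reasoning
      a = stability p l
      lem : ∀ x y z → x + (y + z) ≡ y + x + z
      lem = solve-∀
    -- Now α = b + 1, and the two induction hypotheses are added. Since 2^x - x is nondecreasing and
    -- b ≤ a, 2^a - a may be replaced by 2^b - b (`gap`). The surplus b comes from the order of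
    -- `p ∩ v`, which is at least b. Adding `a + b` to both sides avoids subtraction.
    ...   | inj₁ a≤ rewrite m≤n⇒m⊔n≡n a≤ = +-cancelʳ-≤ (a + b) _ _ (begin
      (2 ^ suc b + suc (order p l)) + (a + b) ≡⟨ lem₁ (2 ^ b) (order p l) a b ⟩
      (2 ^ b + a) + (2 ^ b + (order p l + suc b)) ≤⟨ +-mono-≤ (gap (stability-mono l (∩-sub p v l))) (+-monoʳ-≤ (2 ^ b) (+-monoʳ-≤ (order p l) (s≤s (stability≤order (p ∩ v) l)))) ⟩
      (2 ^ a + b) + (2 ^ b + (order p l + suc (order (p ∩ v) l))) ≡⟨ lem₂ (2 ^ a) b (2 ^ b) (order p l) (order (p ∩ v) l) ⟩
      (2 ^ a + order p l) + (2 ^ b + order (p ∩ v) l) + suc b ≤⟨ +-monoˡ-≤ (suc b) (+-mono-≤ (stables-lower p l) (stables-lower (p ∩ v) l)) ⟩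
      (stables p l + a) + (stables (p ∩ v) l + b) + suc b ≡⟨ lem₃ (stables p l) (stables (p ∩ v) l) a b ⟩
      (stables p l + stables (p ∩ v) l + suc b) + (a + b) ∎)
      where
      open ≤-Reasoning
      a = stability p l
      b = stability (p ∩ v) l
      gap-step : ∀ b k → 2 ^ b + (k + b) ≤ 2 ^ (k + b) + b
      gap-step b zero    = ≤-refl
      gap-step b (suc k) = begin
        2 ^ b + suc (k + b)             ≡⟨ +-suc _ _ ⟩
        1 + (2 ^ b + (k + b))           ≤⟨ +-mono-≤ (m^n>0 2 (k + b)) (gap-step b k) ⟩
        2 ^ (k + b) + (2 ^ (k + b) + b) ≡⟨ lem (2 ^ (k + b)) b ⟩
        2 ^ suc (k + b) + b             ∎
        where
        lem : ∀ x b → x + (x + b) ≡ 2 * x + b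
        lem = solve-∀
      gap : ∀ {b a} → b ≤ a → 2 ^ b + a ≤ 2 ^ a + b
      gap {b} {a} b≤a = subst (λ a → 2 ^ b + a ≤ 2 ^ a + b) (m∸n+n≡m b≤a) (gap-step b (a ∸ b))
      lem₁ : ∀ x n a b → (2 * x + suc n) + (a + b) ≡ (x + a) + (x + (n + suc b))
      lem₁ = solve-∀
      lem₂ : ∀ x b y n m → (x + b) + (y + (n + suc m)) ≡ (x + n) + (y + m) + suc b
      lem₂ = solve-∀
      lem₃ : ∀ x y a b → (x + a) + (y + b) + suc b ≡ (x + y + suc b) + (a + b)
      lem₃ = solve-∀

  -- Comparison of the recursive bound with the upper line

  -- With n = p + 1 vertices, rise p = 2^n - n - 1 is the height difference between the endpoints
  -- (1 , n + 1) and (n , 2^n) of the upper edge.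
  rise : ℕ → ℕ
  rise zero    = 0
  rise (suc p) = 2 * rise p + suc p

  rise+p+2 : ∀ p → rise p + (p + 2) ≡ 2 ^ suc p
  rise+p+2 zero    = refl
  rise+p+2 (suc p) = trans (lem (rise p) p) (cong (2 *_) (rise+p+2 p))
    where
    lem : ∀ x p → (2 * x + suc p) + (suc p + 2) ≡ 2 * (x + (p + 2))
    lem = solve-∀

  -- With denominators cleared, the induction steps below become polynomial inequalities in p, the
  -- index c and x = `rise p`. They follow once x is known to be at least (p + 1)^2.
  square≤rise : ∀ q → (q + 6) * (q + 6) ≤ rise (q + 5)
  square≤rise zero    = m≤m+n 36 21
  square≤rise (suc q) = begin
    (suc q + 6) * (suc q + 6)                         ≤⟨ m≤m+n _ (q * q + 11 * q + 29) ⟩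
    (suc q + 6) * (suc q + 6) + (q * q + 11 * q + 29) ≡⟨ lem q ⟩
    2 * ((q + 6) * (q + 6)) + suc (q + 5)             ≤⟨ +-monoˡ-≤ _ (*-monoʳ-≤ 2 (square≤rise q)) ⟩
    rise (suc q + 5)                                  ∎
    where
    open ≤-Reasoning
    lem : ∀ q → (suc q + 6) * (suc q + 6) + (q * q + 11 * q + 29) ≡ 2 * ((q + 6) * (q + 6)) + suc (q + 5)
    lem = solve-∀

  bound≤2^ : ∀ n a → bound n a ≤ 2 ^ n
  bound≤2^ zero          a       = ≤-refl
  bound≤2^ (suc n)       zero    = m^n>0 2 (suc n)
  bound≤2^ (suc zero)    (suc a) = ≤-refl
  bound≤2^ (suc (suc n)) (suc a) = ⊔-lub
    (begin
      bound (suc n) (suc a) + bound n a ≤⟨ +-mono-≤ (bound≤2^ (suc n) (suc a)) (≤-trans (bound≤2^ n a) (m≤m+n _ _)) ⟩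
      2 ^ suc n + 2 ^ suc n             ≡⟨ cong (2 ^ suc n +_) (sym (+-identityʳ _)) ⟩
      2 ^ suc (suc n)                   ∎)
    (*-monoʳ-≤ 2 (bound≤2^ (suc n) a))
    where open ≤-Reasoning

  bound-clique : ∀ n → bound n 1 ≤ suc n
  bound-clique zero          = ≤-refl
  bound-clique (suc zero)    = ≤-refl
  bound-clique (suc (suc n)) = ⊔-lub (≤-trans (+-mono-≤ (bound-clique (suc n)) (bound-0 n)) (≤-reflexive (+-comm _ 1))) (s≤s (s≤s z≤n))
    where
    bound-0 : ∀ n → bound n 0 ≤ 1
    bound-0 zero    = ≤-refl
    bound-0 (suc n) = ≤-refl

  -- The upper inequality for n = p + 1 and α = b + 1, multiplied by n - 1.
  BelowLine : ℕ → Set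
  BelowLine p = ∀ b → b ≤ p → p * bound (suc p) (suc b) ≤ p * (p + 2) + rise p * b

  below-top : ∀ p a → p * bound (suc p) a ≤ p * (p + 2) + rise p * p
  below-top p a = begin
    p * bound (suc p) a      ≤⟨ *-monoʳ-≤ p (bound≤2^ (suc p) a) ⟩
    p * 2 ^ suc p            ≡⟨ cong (p *_) (rise+p+2 p) ⟨
    p * (rise p + (p + 2))   ≡⟨ lem p (rise p) ⟩
    p * (p + 2) + rise p * p ∎
    where
    open ≤-Reasoning
    lem : ∀ p x → p * (x + (p + 2)) ≡ p * (p + 2) + x * p
    lem = solve-∀

  -- An isolated vertex doubles F and raises α by one, while `2 * x + suc p` is the next value of
  -- `rise`. The slack is a multiple of d = p - c. It vanishes at c = p, as it must: an edgeless
  -- graph stays edgeless and its point is the end of the line.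
  below-isolated : ∀ p c {x h} → suc p * suc p ≤ x → c ≤ p → .{{_ : NonZero p}} →
    p * h ≤ p * (p + 2) + x * c →
    suc p * (2 * h) ≤ suc p * (suc p + 2) + (2 * x + suc p) * suc c
  below-isolated p c {x} {h} x≥ c≤p hyp with m≤n⇒∃[o]m+o≡n x≥ | m≤n⇒∃[o]m+o≡n c≤p
  ... | e , refl | d , refl = *-cancelˡ-≤ (c + d) (begin
    p * (suc p * (2 * h)) ≡⟨ lem₁ p h ⟩
    2 * suc p * (p * h) ≤⟨ *-monoʳ-≤ (2 * suc p) hyp ⟩
    2 * suc p * (p * (p + 2) + x * c) ≤⟨ m≤m+n _ (d * (suc p * (p + 2) + 2 * e)) ⟩
    2 * suc p * (p * (p + 2) + x * c) + d * (suc p * (p + 2) + 2 * e) ≡⟨ lem₂ c d e ⟩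
    p * (suc p * (suc p + 2) + (2 * x + suc p) * suc c) ∎)
    where
    open ≤-Reasoning
    lem₁ : ∀ p h → p * (suc p * (2 * h)) ≡ 2 * suc p * (p * h)
    lem₁ = solve-∀
    lem₂ : ∀ c d e → 2 * suc (c + d) * ((c + d) * (c + d + 2) + (suc (c + d) * suc (c + d) + e) * c) + d * (suc (c + d) * (c + d + 2) + 2 * e)
       ≡ (c + d) * (suc (c + d) * (suc (c + d) + 2) + (2 * (suc (c + d) * suc (c + d) + e) + suc (c + d)) * suc c)
    lem₂ = solve-∀

  -- The explicit summands of m≤m+n here and above are the slack in the inequality once the
  -- hypothesis x ≥ (p + 1)^2 is written as an equation.
  below-neighbour : ∀ q c {x h₁ h₂} → let p = q + 5 in (q + 6) * (q + 6) ≤ x →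
    suc p * h₁ ≤ suc p * (suc p + 2) + (2 * x + suc p) * suc c →
    p * h₂ ≤ p * (p + 2) + x * c →
    suc (suc p) * (h₁ + h₂) ≤
      suc (suc p) * (suc (suc p) + 2) + (2 * (2 * x + suc p) + suc (suc p)) * suc c
  below-neighbour q c {x} {h₁} {h₂} x≥ hyp₁ hyp₂ with m≤n⇒∃[o]m+o≡n x≥
  ... | e , refl = *-cancelˡ-≤ (p * suc p) {{m*n≢0 p (suc p) {{>-nonZero (m≤n⇒m≤o+n q (s≤s z≤n))}}}} (begin
    p * suc p * (suc (suc p) * (h₁ + h₂)) ≡⟨ lem₁ p h₁ h₂ ⟩
    suc (suc p) * p * (suc p * h₁) + suc (suc p) * suc p * (p * h₂)
      ≤⟨ +-mono-≤ (*-monoʳ-≤ (suc (suc p) * p) hyp₁) (*-monoʳ-≤ (suc (suc p) * suc p) hyp₂) ⟩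
    suc (suc p) * p * (suc p * (suc p + 2) + (2 * x + suc p) * suc c) + suc (suc p) * suc p * (p * (p + 2) + x * c)
      ≤⟨ m≤m+n _ (c * (x * (q * q + 7 * q + 8) + 2 * p * suc p * suc p) + p * p * (x + e)) ⟩
    suc (suc p) * p * (suc p * (suc p + 2) + (2 * x + suc p) * suc c) + suc (suc p) * suc p * (p * (p + 2) + x * c)
      + (c * (x * (q * q + 7 * q + 8) + 2 * p * suc p * suc p) + p * p * (x + e)) ≡⟨ lem₂ q c e ⟩
    p * suc p * (suc (suc p) * (suc (suc p) + 2) + (2 * (2 * x + suc p) + suc (suc p)) * suc c) ∎)
    where
    open ≤-Reasoning
    p = q + 5
    lem₁ : ∀ p h₁ h₂ → p * suc p * (suc (suc p) * (h₁ + h₂)) ≡ suc (suc p) * p * (suc p * h₁) + suc (suc p) * suc p * (p * h₂)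
    lem₁ = solve-∀
    lem₂ : ∀ q c e → let p = q + 5; x = (q + 6) * (q + 6) + e in
      suc (suc p) * p * (suc p * (suc p + 2) + (2 * x + suc p) * suc c) + suc (suc p) * suc p * (p * (p + 2) + x * c)
      + (c * (x * (q * q + 7 * q + 8) + 2 * p * suc p * suc p) + p * p * (x + e))
      ≡ p * suc p * (suc (suc p) * (suc (suc p) + 2) + (2 * (2 * x + suc p) + suc (suc p)) * suc c)
    lem₂ = solve-∀

  -- Both ends need separate arguments: at b = n the recursion would ask for a value beyond the
  -- range of the previous `BelowLine`, and at b = 0 for stability bound 0, below its range. The
  -- estimates 2^n and n + 1 settle them.
  below-step : ∀ q → BelowLine (q + 5) → BelowLine (suc (q + 5)) → BelowLine (suc (suc (q + 5)))
  below-step q below₁ below₂ b b≤ with m≤n⇒m<n∨m≡n b≤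
  ... | inj₂ refl = below-top b (suc b)
  below-step q below₁ below₂ zero _ | inj₁ _ = begin
    n * bound (suc n) 1      ≤⟨ *-monoʳ-≤ n (bound-clique (suc n)) ⟩
    n * (2 + n)              ≡⟨ cong (n *_) (+-comm 2 n) ⟩
    n * (n + 2)              ≤⟨ m≤m+n _ _ ⟩
    n * (n + 2) + rise n * 0 ∎
    where
    open ≤-Reasoning
    n = suc (suc (q + 5))
  below-step q below₁ below₂ (suc c) _ | inj₁ (s≤s c<) = begin
    n * ((h₁ + h₂) ⊔ 2 * h₃)     ≡⟨ *-distribˡ-⊔ n (h₁ + h₂) (2 * h₃) ⟩
    n * (h₁ + h₂) ⊔ n * (2 * h₃) ≤⟨ ⊔-lub
       (below-neighbour q c {rise p} {h₁} {h₂} (square≤rise q) (below₂ (suc c) c<) (below₁ c (s≤s⁻¹ c<)))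
       (below-isolated (suc p) c {rise (suc p)} {h₃}
          (subst (λ k → k * k ≤ rise (suc p)) (cong suc (+-suc q 5)) (square≤rise (suc q)))
          (m≤n⇒m≤1+n (s≤s⁻¹ c<)) (below₂ c (m≤n⇒m≤1+n (s≤s⁻¹ c<)))) ⟩
    n * (n + 2) + rise n * suc c ∎
    where
    open ≤-Reasoning
    p = q + 5
    n = suc (suc p)
    h₁ = bound n (suc (suc c))
    h₂ = bound (suc p) (suc c)
    h₃ = bound n (suc c)

  -- The induction starts at n = 6 , 7 because bound 5 2 exceeds the upper line.
  below-5 : BelowLine 5
  below-5 b b≤5 = from-yes (allUpTo? (λ b → 5 * bound 6 (suc b) ≤? 35 + rise 5 * b) 6) (s≤s b≤5)

  below-6 : BelowLine 6
  below-6 b b≤6 = from-yes (allUpTo? (λ b → 6 * bound 7 (suc b) ≤? 48 + rise 6 * b) 7) (s≤s b≤6)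

  below : ∀ q → BelowLine (q + 5) × BelowLine (suc (q + 5))
  below zero    = below-5 , below-6
  below (suc q) = let h₁ , h₂ = below q in h₂ , below-step q h₁ h₂

  upper-five : ∀ {y b} → b ≤ 4 → y ≤ bound 5 (suc b) → (b ≡ 1 → y ≤ 12) → 4 * y ≤ 24 + rise 4 * b
  upper-five {b = 0} _ h _ = *-monoʳ-≤ 4 h
  -- At α = 2 the line has height 12.5, so 12 stable sets are allowed and 13 are not.
  upper-five {b = 1} _ _ h = ≤-trans (*-monoʳ-≤ 4 (h refl)) (m≤m+n 48 2)
  upper-five {b = 2} _ h _ = ≤-trans (*-monoʳ-≤ 4 h) (m≤m+n 72 4)
  upper-five {b = 3} _ h _ = ≤-trans (*-monoʳ-≤ 4 h) (m≤m+n 96 6)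
  upper-five {b = 4} _ h _ = *-monoʳ-≤ 4 h
  upper-five {b = suc (suc (suc (suc (suc _))))} (s≤s (s≤s (s≤s (s≤s ())))) _ _

  module _ {V : Set} (indep : V → V → Bool) where
    open Counting indep
    stables-upper : ∀ p l n → order p l ≡ suc n → 4 ≤ n → 1 ≤ stability p l →
      n * stables p l ≤ n * (n + 2) + rise n * (stability p l ∸ 1)
    stables-upper p l n order≡ 4≤n 1≤stability with stability p l in stability≡ | subst (stability p l ≤_) order≡ (stability≤order p l)
    ... | suc b | s≤s b≤n with m≤n⇒∃[o]m+o≡n 4≤n
    -- Here `n` is the order minus one, so this is the case of five vertices.
    ...   | zero , refl = upper-five b≤n
               (stables≤bound′ p l (≤-reflexive order≡) (≤-reflexive stability≡))
               λ { refl → stables-five p l order≡ (≤-reflexive stability≡) }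
    ...   | suc q , refl = ≤-trans (*-monoʳ-≤ n (stables≤bound′ p l (≤-reflexive order≡) (≤-reflexive stability≡)))
               (subst BelowLine (trans (+-comm q 5) (sym (+-suc 4 q))) (proj₁ (below q)) b b≤n)

  -- Agreement of the branching counts with `F` and `α`

  maximum : List ℕ → ℕ
  maximum = foldr _⊔_ 0

  maximum-++ : ∀ xs ys → maximum (xs ++ ys) ≡ maximum xs ⊔ maximum ys
  maximum-++ []       ys = refl
  maximum-++ (x ∷ xs) ys = trans (cong (x ⊔_) (maximum-++ xs ys)) (sym (⊔-assoc x _ _))

  -- Nonemptiness matters because the empty list has the default maximum 0.
  maximum-map-suc : ∀ xs → 1 ≤ length xs → maximum (map suc xs) ≡ suc (maximum xs)
  maximum-map-suc (x ∷ [])     _ = cong suc (sym (⊔-identityʳ x))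
  maximum-map-suc (x ∷ y ∷ xs) _ = cong (suc x ⊔_) (maximum-map-suc (y ∷ xs) (s≤s z≤n))

  filter-map : ∀ {X Y : Set} {P : Y → Set} (P? : Decidable P) (g : X → Y) xs →
    filter P? (map g xs) ≡ map g (filter (P? ∘ g) xs)
  filter-map P? g []       = refl
  filter-map P? g (x ∷ xs) with does (P? (g x))
  ... | true  = cong (g x ∷_) (filter-map P? g xs)
  ... | false = filter-map P? g xs

  module Sizes {V : Set} (edge : V → V → Bool)
    (edge-sym : ∀ u v → edge u v ≡ edge v u) (edge-irref : ∀ v → edge v v ≡ false) where

    indep : V → V → Bool
    indep u v = not (edge u v)

    open Counting indep public

    -- The branching lists cardinalities in the order in which `allSubsets` enumerates the sets. A
    -- single list equality thus yields `F` as a length and `α` as a maximum.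
    sizes : (V → Bool) → List V → List ℕ
    sizes p []      = 0 ∷ []
    sizes p (v ∷ l) = if p v then sizes p l ++ map suc (sizes (p ∩ v) l) else sizes p l

    length-sizes : ∀ p l → length (sizes p l) ≡ stables p l
    length-sizes p []      = refl
    length-sizes p (v ∷ l) with p v
    ... | false = length-sizes p l
    ... | true  = trans (length-++ (sizes p l))
      (cong₂ _+_ (length-sizes p l) (trans (length-map ℕ.suc (sizes (p ∩ v) l)) (length-sizes (p ∩ v) l)))

    maximum-sizes : ∀ p l → maximum (sizes p l) ≡ stability p l
    maximum-sizes p []      = refl
    maximum-sizes p (v ∷ l) with p v
    ... | false = maximum-sizes p l
    ... | true  = trans (maximum-++ (sizes p l) _)
      (cong₂ _⊔_ (maximum-sizes p l)
        (trans (maximum-map-suc (sizes (p ∩ v) l) (subst (1 ≤_) (sym (length-sizes (p ∩ v) l)) (1≤stables (p ∩ v) l)))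
               (cong suc (maximum-sizes (p ∩ v) l))))

    -- The map `f` places the vertices still to be decided in the fixed type `V`, and the mask `p`
    -- remembers which of them avoid the neighbours of vertices already chosen.
    Admissible : ∀ {m} → (Fin m → V) → (V → Bool) → Subset m → Set
    Admissible f p S = (∀ i → i ∈ S → p (f i) ≡ true)
                     × (∀ i j → i ∈ S → j ∈ S → edge (f i) (f j) ≡ false)

    module _ {m} (f : Fin (suc m) → V) (p : V → Bool) {S : Subset m} where

      skip : Admissible f p (false ∷ S) → Admissible (f ∘ suc) p S
      skip (in-p , stab) = (λ i i∈ → in-p (suc i) (there i∈))
                         , (λ i j i∈ j∈ → stab (suc i) (suc j) (there i∈) (there j∈))

      skip⁻¹ : Admissible (f ∘ suc) p S → Admissible f p (false ∷ S)
      skip⁻¹ (in-p , stab) = (λ { (suc i) (there i∈) → in-p i i∈ })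
                           , (λ { (suc i) (suc j) (there i∈) (there j∈) → stab i j i∈ j∈ })

      take : Admissible f p (true ∷ S) → Admissible (f ∘ suc) (p ∩ f zero) S
      take (in-p , stab) = (λ i i∈ → cong₂ _∧_ (in-p (suc i) (there i∈))
                                               (cong not (stab zero (suc i) here (there i∈))))
                         , (λ i j i∈ j∈ → stab (suc i) (suc j) (there i∈) (there j∈))

      take⁻¹ : p (f zero) ≡ true → Admissible (f ∘ suc) (p ∩ f zero) S → Admissible f p (true ∷ S)
      take⁻¹ pf (in-p , stab) = in-p′ , stab′
        where
        no-edge : ∀ i → i ∈ S → edge (f zero) (f (suc i)) ≡ false
        no-edge i i∈ with p (f (suc i)) | edge (f zero) (f (suc i)) | in-p i i∈
        ... | true | false | _ = refl
        in-p′ : ∀ i → i ∈ (true ∷ S) → p (f i) ≡ true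
        in-p′ zero    here       = pf
        in-p′ (suc i) (there i∈) with p (f (suc i)) | in-p i i∈
        ... | true | _ = refl
        stab′ : ∀ i j → i ∈ (true ∷ S) → j ∈ (true ∷ S) → edge (f i) (f j) ≡ false
        stab′ zero    zero    here       here       = edge-irref (f zero)
        stab′ zero    (suc j) here       (there j∈) = no-edge j j∈
        stab′ (suc i) zero    (there i∈) here       = trans (edge-sym _ _) (no-edge i i∈)
        stab′ (suc i) (suc j) (there i∈) (there j∈) = stab i j i∈ j∈

    -- The predicate is arbitrary up to equivalence because, once a bit of the subset is fixed, the
    -- filter no longer tests literally for stability in a graph on the remaining vertices.
    sizes-admissible : ∀ {m} (f : Fin m → V) p {P : Subset m → Set} (P? : Decidable P) →
      P ≐ Admissible f p → map ∣_∣ (filter P? (allSubsets m)) ≡ sizes p (tabulate f)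
    sizes-admissible {zero} f p P? (_ , from) =
      cong (map ∣_∣) (filter-accept P? {xs = []} (from ((λ ()) , (λ ()))))
    sizes-admissible {suc m} f p {P} P? (to , from) = begin
      map ∣_∣ (filter P? (map (false ∷_) xs ++ map (true ∷_) xs))
        ≡⟨ cong (map ∣_∣) (filter-++ P? (map (false ∷_) xs) _) ⟩
      map ∣_∣ (filter P? (map (false ∷_) xs) ++ filter P? (map (true ∷_) xs))
        ≡⟨ map-++ ∣_∣ (filter P? (map (false ∷_) xs)) _ ⟩
      map ∣_∣ (filter P? (map (false ∷_) xs)) ++ map ∣_∣ (filter P? (map (true ∷_) xs))
        ≡⟨ cong₂ (λ ys zs → map ∣_∣ ys ++ map ∣_∣ zs) (filter-map P? (false ∷_) xs) (filter-map P? (true ∷_) xs) ⟩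
      map ∣_∣ (map (false ∷_) out) ++ map ∣_∣ (map (true ∷_) inn)
        ≡⟨ cong₂ _++_ (map-∘ out) (map-∘ inn) ⟨
      map ∣_∣ out ++ map (suc ∘ ∣_∣) inn
        ≡⟨ cong₂ _++_ (sizes-admissible (f ∘ suc) p (P? ∘ (false ∷_)) (skip f p ∘ to , from ∘ skip⁻¹ f p)) (map-∘ inn) ⟩
      sizes p (tabulate (f ∘ suc)) ++ map suc (map ∣_∣ inn)
        ≡⟨ last ⟩
      sizes p (tabulate f) ∎
      where
      open ≡-Reasoning
      xs = allSubsets m
      out = filter (P? ∘ (false ∷_)) xs
      inn = filter (P? ∘ (true ∷_)) xs
      last : sizes p (tabulate (f ∘ suc)) ++ map suc (map ∣_∣ inn) ≡ sizes p (tabulate f)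
      last with p (f zero) in eq
      ... | true  = cong (λ ys → sizes p (tabulate (f ∘ suc)) ++ map suc ys)
        (sizes-admissible (f ∘ suc) (p ∩ f zero) (P? ∘ (true ∷_)) (take f p ∘ to , from ∘ take⁻¹ f p eq))
      -- The vertex is masked out, so no subset containing it passes the filter.
      ... | false = trans (cong (λ ys → sizes p (tabulate (f ∘ suc)) ++ map suc (map ∣_∣ ys))
                            (filter-none (P? ∘ (true ∷_)) (All.universal excluded xs)))
                          (++-identityʳ _)
        where
        excluded : ∀ S → ¬ P (true ∷ S)
        excluded S PS with trans (sym eq) (proj₁ (to PS) zero here)
        ... | ()

    stables-none : ∀ p l → All (λ v → p v ≡ false) l → stables p l ≡ 1
    stables-none p []      []      = refl
    stables-none p (v ∷ l) (h ∷ hs) rewrite h = stables-none p l hs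

    stability-none : ∀ p l → All (λ v → p v ≡ false) l → stability p l ≡ 0
    stability-none p []      []      = refl
    stability-none p (v ∷ l) (h ∷ hs) rewrite h = stability-none p l hs

    order-all : ∀ p l → All (λ v → p v ≡ true) l → order p l ≡ length l
    order-all p []      []      = refl
    order-all p (v ∷ l) (h ∷ hs) rewrite h = cong suc (order-all p l hs)

    1≤stability : ∀ p l → 1 ≤ order p l → 1 ≤ stability p l
    1≤stability p (v ∷ l) h with p v
    ... | true  = m≤n⇒m≤o⊔n (stability p l) (s≤s z≤n)
    ... | false = 1≤stability p l h

    module _ (edgeless : ∀ u v → edge u v ≡ false) where
      ∩-all : ∀ {p} v l → All (λ v → p v ≡ true) l → All (λ w → (p ∩ v) w ≡ true) l
      ∩-all v l = All.map λ {w} h → cong₂ _∧_ h (cong not (edgeless v w))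

      stables-edgeless : ∀ p l → All (λ v → p v ≡ true) l → stables p l ≡ 2 ^ length l
      stables-edgeless p []      []      = refl
      stables-edgeless p (v ∷ l) (h ∷ hs) rewrite h = trans
        (cong₂ _+_ (stables-edgeless p l hs) (stables-edgeless (p ∩ v) l (∩-all v l hs)))
        (cong (2 ^ length l +_) (sym (+-identityʳ _)))

      stability-edgeless : ∀ p l → All (λ v → p v ≡ true) l → stability p l ≡ length l
      stability-edgeless p []      []      = refl
      stability-edgeless p (v ∷ l) (h ∷ hs) rewrite h = trans
        (cong₂ (λ a b → a ⊔ suc b) (stability-edgeless p l hs) (stability-edgeless (p ∩ v) l (∩-all v l hs)))
        (m≤n⇒m⊔n≡n (n≤1+n (length l)))

  everything : ∀ {V : Set} → V → Bool
  everything _ = true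

  module _ {n} (G : Graph n) where
    open Sizes (adj G) (Graph.sym G) (irref G)

    F≡stables : F G ≡ stables everything (allFin n)
    F≡stables = trans (sym (length-map ∣_∣ (stableSets G)))
      (trans (cong length (sizes-admissible (λ i → i) everything (stable? G) ((λ s → (λ _ _ → refl) , s) , proj₂)))
             (length-sizes everything (allFin n)))

    α≡stability : α G ≡ stability everything (allFin n)
    α≡stability = trans
      (cong maximum (sizes-admissible (λ i → i) everything (stable? G) ((λ s → (λ _ _ → refl) , s) , proj₂)))
      (maximum-sizes everything (allFin n))

    order≡n : order everything (allFin n) ≡ n
    order≡n = trans (order-all everything (allFin n) (All.universal (λ _ → refl) _)) (length-tabulate {n = n} (λ i → i))

    F-lower : 2 ^ α G + n ≤ F G + α G
    F-lower = subst₂ _≤_ (cong₂ (λ a n → 2 ^ a + n) (sym α≡stability) order≡n) (cong₂ _+_ (sym F≡stables) (sym α≡stability))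
      (stables-lower everything (allFin n))

  α-positive : ∀ {n} (G : Graph (suc n)) → 1 ≤ α G
  α-positive G = subst (1 ≤_) (sym (α≡stability G)) (1≤stability everything (allFin _) (s≤s z≤n))
    where open Sizes (adj G) (Graph.sym G) (irref G)

  F-upper : ∀ {n} (G : Graph (suc n)) → 4 ≤ n → n * F G ≤ n * (n + 2) + rise n * (α G ∸ 1)
  F-upper {n} G 4≤n = subst₂ (λ x a → n * x ≤ n * (n + 2) + rise n * (a ∸ 1)) (sym (F≡stables G)) (sym (α≡stability G))
    (stables-upper indep everything (allFin _) n (order≡n G) 4≤n (1≤stability everything (allFin _) (s≤s z≤n)))
    where open Sizes (adj G) (Graph.sym G) (irref G)

  -- The extremal graphs

  edgeless : ∀ k → Graph k
  edgeless k = record { adj = λ _ _ → false ; sym = λ _ _ → refl ; irref = λ _ → refl }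

  F-edgeless : ∀ k → F (edgeless k) ≡ 2 ^ k
  F-edgeless k = trans (F≡stables (edgeless k))
    (trans (stables-edgeless (λ _ _ → refl) everything (allFin k) (All.universal (λ _ → refl) _))
           (cong (2 ^_) (length-tabulate {n = k} (λ i → i))))
    where open Sizes {Fin k} (λ _ _ → false) (λ _ _ → refl) (λ _ → refl)

  α-edgeless : ∀ k → α (edgeless k) ≡ k
  α-edgeless k = trans (α≡stability (edgeless k))
    (trans (stability-edgeless (λ _ _ → refl) everything (allFin k) (All.universal (λ _ → refl) _))
           (length-tabulate {n = k} (λ i → i)))
    where open Sizes {Fin k} (λ _ _ → false) (λ _ _ → refl) (λ _ → refl)

  cone : ∀ {n} → Graph n → Graph (suc n)
  cone {n} G = record { adj = edge ; sym = edge-sym ; irref = edge-irref }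
    where
    edge : Fin (suc n) → Fin (suc n) → Bool
    edge zero    zero    = false
    edge zero    (suc j) = true
    edge (suc i) zero    = true
    edge (suc i) (suc j) = adj G i j
    edge-sym : ∀ i j → edge i j ≡ edge j i
    edge-sym zero    zero    = refl
    edge-sym zero    (suc j) = refl
    edge-sym (suc i) zero    = refl
    edge-sym (suc i) (suc j) = Graph.sym G i j
    edge-irref : ∀ i → edge i i ≡ false
    edge-irref zero    = refl
    edge-irref (suc i) = irref G i

  module _ {n} (G : Graph n) where
    open Sizes (adj (cone G)) (Graph.sym (cone G)) (irref (cone G))

    -- On the vertices other than the apex, adjacency in the cone reduces to that of `G`. Branching
    -- over them inside the cone therefore counts the stable sets of `G`, and the singleton of the
    -- apex is the only further one.
    base-sizes : map ∣_∣ (stableSets G) ≡ sizes everything (tabulate suc)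
    base-sizes = sizes-admissible suc everything (stable? G) ((λ s → (λ _ _ → refl) , s) , proj₂)

    apex-adjacent : All (λ v → (everything ∩ zero) v ≡ false) (tabulate {n = n} suc)
    apex-adjacent = AllP.tabulate⁺ λ _ → refl

    F-cone : F (cone G) ≡ suc (F G)
    F-cone = begin
      F (cone G)                                           ≡⟨ F≡stables (cone G) ⟩
      stables everything l + stables (everything ∩ zero) l ≡⟨ cong₂ _+_ (sym (length-sizes everything l)) (stables-none _ l apex-adjacent) ⟩
      length (sizes everything l) + 1                      ≡⟨ +-comm _ 1 ⟩
      suc (length (sizes everything l))                    ≡⟨ cong (suc ∘ length) base-sizes ⟨
      suc (length (map ∣_∣ (stableSets G)))                ≡⟨ cong suc (length-map ∣_∣ (stableSets G)) ⟩
      suc (F G)                                            ∎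
      where
      open ≡-Reasoning
      l = tabulate suc

    α-cone : α (cone G) ≡ α G ⊔ 1
    α-cone = trans (α≡stability (cone G)) (cong₂ (λ a b → a ⊔ suc b)
      (trans (sym (maximum-sizes everything (tabulate suc))) (cong maximum (sym base-sizes)))
      (stability-none (everything ∩ zero) (tabulate suc) apex-adjacent))

  -- The vertices of the polygon, attained by k independent vertices joined to a clique on the
  -- n - k others.
  Extremal : ∀ {n} → ℕ → Graph n → Set
  Extremal {n} k G = α G ≡ k × F G + k ≡ 2 ^ k + n

  -- Start from k independent vertices and take n - k cones: each adds one to both F and n, and k ≥
  -- 1 keeps α unchanged.
  extremal : ∀ {n k} → 1 ≤ k → k ≤ n → Σ (Graph n) (Extremal k)
  extremal {n} {k} 1≤k k≤n = go (≤⇒≤′ k≤n)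
    where
    go : ∀ {n} → k ≤′ n → Σ (Graph n) (Extremal k)
    go (≤′-reflexive refl) = edgeless k , α-edgeless k , cong (_+ k) (F-edgeless k)
    go (≤′-step h) with go h
    ... | G , α≡ , F≡ = cone G
      , trans (α-cone G) (trans (cong (_⊔ 1) α≡) (m≥n⇒m⊔n≡m 1≤k))
      , trans (cong (_+ k) (F-cone G)) (trans (cong suc F≡) (sym (+-suc (2 ^ k) _)))

module Polygon where

  import Algebra.Properties.Group as GroupP
  open import Data.Integer as ℤ using (ℤ; +_)
  import Data.Integer.Properties as ℤP
  import Data.Integer.Tactic.RingSolver as ℤSolver
  open import Data.List using (List; []; _∷_; foldr)
  open import Data.List.Membership.Propositional using () renaming (_∈_ to _∈ˡ_)
  open import Data.List.Relation.Unary.Any using (here; there)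
  open import Data.Nat as ℕ using (ℕ; zero; suc; _^_; _∸_; s≤s; z≤n)
  import Data.Nat.Properties as ℕP
  import Data.Nat.Tactic.RingSolver as ℕSolver
  open import Data.Product using (Σ; _×_; _,_; proj₁; proj₂; ∃-syntax)
  open import Data.Rational as ℚ using (ℚ; 0ℚ; 1ℚ; _+_; _*_; _-_; -_; _≤_; _<_; _/_; 1/_; toℚᵘ)
  import Data.Rational.Properties as ℚP
  open import Data.Rational.Unnormalised as ℚᵘ using (mkℚᵘ; *≡*; _≃_)
  import Data.Rational.Unnormalised.Properties as ℚᵘP
  open import Data.Sum using (inj₁; inj₂)
  open import Defs using (Graph; F; α; ℕ→ℚ; ℤ→ℚ; pt; InConvHull; FacetLine; lowerRHS; upperRHS)
  open import Function using (_∘_)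
  open import Level using (0ℓ)
  open import Relation.Binary.PropositionalEquality
  open import Relation.Nullary using (yes; no)
  open import Relation.Nullary.Decidable using (dec⇒maybe)
  open StableSets
  open import Tactic.RingSolver using (solve-∀)
  open import Tactic.RingSolver.Core.AlmostCommutativeRing using (AlmostCommutativeRing; fromCommutativeRing)

  -- Integers inside the rationals

  ring : AlmostCommutativeRing 0ℓ 0ℓ
  ring = fromCommutativeRing ℚP.+-*-commutativeRing λ x → dec⇒maybe (0ℚ ℚP.≟ x)

  -- Since `z / 1` passes through normalisation by a gcd, the homomorphism laws are checked on
  -- unnormalised rationals and transported back.
  toℚᵘ-ℤ→ℚ : ∀ z → toℚᵘ (ℤ→ℚ z) ≃ mkℚᵘ z 0
  toℚᵘ-ℤ→ℚ z = ℚP.toℚᵘ-fromℚᵘ (mkℚᵘ z 0)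

  ℤ→ℚ-+ : ∀ a b → ℤ→ℚ (a ℤ.+ b) ≡ ℤ→ℚ a + ℤ→ℚ b
  ℤ→ℚ-+ a b = ℚP.toℚᵘ-injective (begin
    toℚᵘ (ℤ→ℚ (a ℤ.+ b))           ≈⟨ toℚᵘ-ℤ→ℚ (a ℤ.+ b) ⟩
    mkℚᵘ (a ℤ.+ b) 0               ≈⟨ *≡* (cong (ℤ._* + 1) (cong₂ ℤ._+_ (ℤP.*-identityʳ a) (ℤP.*-identityʳ b))) ⟨
    mkℚᵘ a 0 ℚᵘ.+ mkℚᵘ b 0         ≈⟨ ℚᵘP.+-cong (toℚᵘ-ℤ→ℚ a) (toℚᵘ-ℤ→ℚ b) ⟨
    toℚᵘ (ℤ→ℚ a) ℚᵘ.+ toℚᵘ (ℤ→ℚ b) ≈⟨ ℚP.toℚᵘ-homo-+ (ℤ→ℚ a) (ℤ→ℚ b) ⟨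
    toℚᵘ (ℤ→ℚ a + ℤ→ℚ b)           ∎)
    where open import Relation.Binary.Reasoning.Setoid ℚᵘP.≃-setoid

  ℤ→ℚ-* : ∀ a b → ℤ→ℚ (a ℤ.* b) ≡ ℤ→ℚ a * ℤ→ℚ b
  ℤ→ℚ-* a b = ℚP.toℚᵘ-injective (begin
    toℚᵘ (ℤ→ℚ (a ℤ.* b))           ≈⟨ toℚᵘ-ℤ→ℚ (a ℤ.* b) ⟩
    mkℚᵘ a 0 ℚᵘ.* mkℚᵘ b 0         ≈⟨ ℚᵘP.*-cong (toℚᵘ-ℤ→ℚ a) (toℚᵘ-ℤ→ℚ b) ⟨
    toℚᵘ (ℤ→ℚ a) ℚᵘ.* toℚᵘ (ℤ→ℚ b) ≈⟨ ℚP.toℚᵘ-homo-* (ℤ→ℚ a) (ℤ→ℚ b) ⟨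
    toℚᵘ (ℤ→ℚ a * ℤ→ℚ b)           ∎)
    where open import Relation.Binary.Reasoning.Setoid ℚᵘP.≃-setoid

  ℤ→ℚ-mono-< : ∀ {a b} → a ℤ.< b → ℤ→ℚ a < ℤ→ℚ b
  ℤ→ℚ-mono-< {a} {b} a<b = ℚP.toℚᵘ-cancel-< (begin-strict
    toℚᵘ (ℤ→ℚ a) ≃⟨ toℚᵘ-ℤ→ℚ a ⟩
    mkℚᵘ a 0     <⟨ ℚᵘ.*<* (ℤP.*-monoʳ-<-pos (+ 1) a<b) ⟩
    mkℚᵘ b 0     ≃⟨ toℚᵘ-ℤ→ℚ b ⟨
    toℚᵘ (ℤ→ℚ b) ∎)
    where open ℚᵘP.≤-Reasoning

  ℕ→ℚ-+ : ∀ a b → ℕ→ℚ (a ℕ.+ b) ≡ ℕ→ℚ a + ℕ→ℚ b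
  ℕ→ℚ-+ a b = ℤ→ℚ-+ (+ a) (+ b)

  ℕ→ℚ-* : ∀ a b → ℕ→ℚ (a ℕ.* b) ≡ ℕ→ℚ a * ℕ→ℚ b
  ℕ→ℚ-* a b = trans (cong ℤ→ℚ (ℤP.pos-* a b)) (ℤ→ℚ-* (+ a) (+ b))

  ℕ→ℚ-mono-< : ∀ {a b} → a ℕ.< b → ℕ→ℚ a < ℕ→ℚ b
  ℕ→ℚ-mono-< a<b = ℤ→ℚ-mono-< (ℤ.+<+ a<b)

  ℕ→ℚ-mono-≤ : ∀ {a b} → a ℕ.≤ b → ℕ→ℚ a ≤ ℕ→ℚ b
  ℕ→ℚ-mono-≤ a≤b with ℕP.m≤n⇒m<n∨m≡n a≤b
  ... | inj₁ a<b  = ℚP.<⇒≤ (ℕ→ℚ-mono-< a<b)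
  ... | inj₂ refl = ℚP.≤-refl

  ℕ→ℚ-positive : ∀ {a} → 0 ℕ.< a → ℚ.Positive (ℕ→ℚ a)
  ℕ→ℚ-positive 0<a = ℚ.positive (ℕ→ℚ-mono-< 0<a)

  *-nonneg : ∀ {p q} → 0ℚ ≤ p → 0ℚ ≤ q → 0ℚ ≤ p * q
  *-nonneg {p} {q} 0≤p 0≤q = ℚP.nonNegative⁻¹ (p * q)
    {{ℚP.nonNeg*nonNeg⇒nonNeg p {{ℚ.nonNegative 0≤p}} q {{ℚ.nonNegative 0≤q}}}}

  0<q-p : ∀ {p q} → p < q → 0ℚ < q - p
  0<q-p {p} {q} p<q = subst (_< q - p) (ℚP.+-inverseʳ p) (ℚP.+-monoˡ-< (- p) p<q)

  0≤q-p : ∀ {p q} → p ≤ q → 0ℚ ≤ q - p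
  0≤q-p {p} {q} p≤q = subst (_≤ q - p) (ℚP.+-inverseʳ p) (ℚP.+-monoˡ-≤ (- p) p≤q)

  -- Segments and affine functions

  lerp : ℚ → ℚ → ℚ → ℚ
  lerp t a b = (1ℚ - t) * a + t * b

  _∈Segment[_,_] : ℚ → ℚ → ℚ → Set
  x ∈Segment[ a , b ] = ∃[ t ] 0ℚ ≤ t × t ≤ 1ℚ × lerp t a b ≡ x

  lerp-onto : ∀ {a b x} → a ≤ x → x ≤ b → x ∈Segment[ a , b ]
  lerp-onto {a} {b} {x} a≤x x≤b with a ℚP.<? b
  -- The hypotheses now force a = x = b. This case does occur: the lower and upper boundaries of the
  -- polygon meet at x = 1 and at x = n.
  ... | no a≮b = 0ℚ , ℚP.≤-refl , ℚP.<⇒≤ (ℚP.positive⁻¹ 1ℚ)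
               , trans (lem a b) (ℚP.≤-antisym a≤x (ℚP.≤-trans x≤b (ℚP.≮⇒≥ a≮b)))
    where
    lem : ∀ a b → (1ℚ - 0ℚ) * a + 0ℚ * b ≡ a
    lem = solve-∀ ring
  ... | yes a<b = t , ℚP.*-cancelʳ-≤-pos δ 0≤tδ , ℚP.*-cancelʳ-≤-pos δ tδ≤δ
                , trans (lem₁ t a b) (trans (cong (λ y → a + y) tδ) (lem₂ a x))
    where
    δ = b - a
    instance
      δ>0 : ℚ.Positive δ
      δ>0 = ℚ.positive (0<q-p a<b)
      δ≢0 : ℚ.NonZero δ
      δ≢0 = ℚP.pos⇒nonZero δ
    t = (x - a) * 1/ δ
    tδ : t * δ ≡ x - a
    tδ = trans (ℚP.*-assoc (x - a) (1/ δ) δ)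
               (trans (cong ((x - a) *_) (ℚP.*-inverseˡ δ)) (ℚP.*-identityʳ (x - a)))
    0≤tδ : 0ℚ * δ ≤ t * δ
    0≤tδ = subst₂ _≤_ (sym (ℚP.*-zeroˡ δ)) (sym tδ) (0≤q-p a≤x)
    tδ≤δ : t * δ ≤ 1ℚ * δ
    tδ≤δ = subst₂ _≤_ (sym tδ) (sym (ℚP.*-identityˡ δ)) (ℚP.+-monoˡ-≤ (- a) x≤b)
    lem₁ : ∀ t a b → (1ℚ - t) * a + t * b ≡ a + t * (b - a)
    lem₁ = solve-∀ ring
    lem₂ : ∀ a x → a + (x - a) ≡ x
    lem₂ = solve-∀ ring

  record Affine (f : ℚ → ℚ) : Set where
    field
      slope intercept : ℚ
      formula         : ∀ x → f x ≡ slope * x + intercept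
  open Affine

  affine-lerp : ∀ {f} → Affine f → ∀ t a b → lerp t (f a) (f b) ≡ f (lerp t a b)
  affine-lerp {f} A t a b = begin
    lerp t (f a) (f b)             ≡⟨ cong₂ (lerp t) (formula A a) (formula A b) ⟩
    lerp t (m * a + c) (m * b + c) ≡⟨ lem m c t a b ⟩
    m * lerp t a b + c             ≡⟨ formula A (lerp t a b) ⟨
    f (lerp t a b)                 ∎
    where
    open ≡-Reasoning
    m = slope A
    c = intercept A
    lem : ∀ m c t a b → (1ℚ - t) * (m * a + c) + t * (m * b + c) ≡ m * ((1ℚ - t) * a + t * b) + c
    lem = solve-∀ ring

  -- With m₁ , m₂ the slopes, f x ≤ g x and f x₀ ≡ g x₀ combine to (m₁ - m₂) (x - x₀) ≤ 0.
  module _ {f g} (Af : Affine f) (Ag : Affine g) {x x₀} (f≤g : f x ≤ g x) (f≡g : f x₀ ≡ g x₀) where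
    private
      m₁ = slope Af
      m₂ = slope Ag
      c₁ = intercept Af
      c₂ = intercept Ag

      crossed : m₁ * x + m₂ * x₀ ≤ m₂ * x + m₁ * x₀
      crossed = begin
        m₁ * x + m₂ * x₀                           ≡⟨ lem₁ m₁ m₂ c₁ c₂ x x₀ ⟩
        (m₁ * x + c₁) + (m₂ * x₀ + c₂) - (c₁ + c₂) ≡⟨ cong₂ (λ u v → u + v - (c₁ + c₂)) (formula Af x) (formula Ag x₀) ⟨
        f x + g x₀ - (c₁ + c₂)                     ≤⟨ ℚP.+-monoˡ-≤ (- (c₁ + c₂)) (ℚP.+-mono-≤ f≤g (ℚP.≤-reflexive (sym f≡g))) ⟩
        g x + f x₀ - (c₁ + c₂)                     ≡⟨ cong₂ (λ u v → u + v - (c₁ + c₂)) (formula Ag x) (formula Af x₀) ⟩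
        (m₂ * x + c₂) + (m₁ * x₀ + c₁) - (c₁ + c₂) ≡⟨ lem₂ m₁ m₂ c₁ c₂ x x₀ ⟩
        m₂ * x + m₁ * x₀                           ∎
        where
        open ℚP.≤-Reasoning
        lem₁ : ∀ m₁ m₂ c₁ c₂ x x₀ → m₁ * x + m₂ * x₀ ≡ (m₁ * x + c₁) + (m₂ * x₀ + c₂) - (c₁ + c₂)
        lem₁ = solve-∀ ring
        lem₂ : ∀ m₁ m₂ c₁ c₂ x x₀ → (m₂ * x + c₂) + (m₁ * x₀ + c₁) - (c₁ + c₂) ≡ m₂ * x + m₁ * x₀
        lem₂ = solve-∀ ring

    steeper-upper⇒≥ : m₁ < m₂ → x₀ ≤ x
    steeper-upper⇒≥ m₁<m₂ = ℚP.*-cancelˡ-≤-pos (m₂ - m₁) {{ℚ.positive (0<q-p m₁<m₂)}} (begin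
      (m₂ - m₁) * x₀                        ≡⟨ lem₁ m₁ m₂ x x₀ ⟩
      m₁ * x + m₂ * x₀ - (m₁ * x + m₁ * x₀) ≤⟨ ℚP.+-monoˡ-≤ (- (m₁ * x + m₁ * x₀)) crossed ⟩
      m₂ * x + m₁ * x₀ - (m₁ * x + m₁ * x₀) ≡⟨ lem₂ m₁ m₂ x x₀ ⟩
      (m₂ - m₁) * x                         ∎)
      where
      open ℚP.≤-Reasoning
      lem₁ : ∀ m₁ m₂ x x₀ → (m₂ - m₁) * x₀ ≡ m₁ * x + m₂ * x₀ - (m₁ * x + m₁ * x₀)
      lem₁ = solve-∀ ring
      lem₂ : ∀ m₁ m₂ x x₀ → m₂ * x + m₁ * x₀ - (m₁ * x + m₁ * x₀) ≡ (m₂ - m₁) * x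
      lem₂ = solve-∀ ring

    steeper-lower⇒≤ : m₂ < m₁ → x ≤ x₀
    steeper-lower⇒≤ m₂<m₁ = ℚP.*-cancelˡ-≤-pos (m₁ - m₂) {{ℚ.positive (0<q-p m₂<m₁)}} (begin
      (m₁ - m₂) * x                         ≡⟨ lem₁ m₁ m₂ x x₀ ⟩
      m₁ * x + m₂ * x₀ - (m₂ * x + m₂ * x₀) ≤⟨ ℚP.+-monoˡ-≤ (- (m₂ * x + m₂ * x₀)) crossed ⟩
      m₂ * x + m₁ * x₀ - (m₂ * x + m₂ * x₀) ≡⟨ lem₂ m₁ m₂ x x₀ ⟩
      (m₁ - m₂) * x₀                        ∎)
      where
      open ℚP.≤-Reasoning
      lem₁ : ∀ m₁ m₂ x x₀ → (m₁ - m₂) * x ≡ m₁ * x + m₂ * x₀ - (m₂ * x + m₂ * x₀)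
      lem₁ = solve-∀ ring
      lem₂ : ∀ m₁ m₂ x x₀ → m₂ * x + m₁ * x₀ - (m₂ * x + m₂ * x₀) ≡ (m₁ - m₂) * x₀
      lem₂ = solve-∀ ring

  -- This selects the edge of the lower boundary that lies over x.
  unit-interval : ∀ {x} m → ℕ→ℚ 1 ≤ x → x ≤ ℕ→ℚ (2 ℕ.+ m) →
    ∃[ k ] 1 ℕ.≤ k × k ℕ.≤ suc m × ℕ→ℚ k ≤ x × x ≤ ℕ→ℚ (suc k)
  unit-interval     zero    1≤x x≤ = 1 , ℕP.≤-refl , ℕP.≤-refl , 1≤x , x≤
  unit-interval {x} (suc m) 1≤x x≤ with ℚP.≤-total x (ℕ→ℚ (2 ℕ.+ m)) | unit-interval {x} m 1≤x
  ... | inj₂ ≤x  | _  = 2 ℕ.+ m , s≤s z≤n , ℕP.≤-refl , ≤x , x≤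
  ... | inj₁ x≤′ | ih = let k , 1≤k , k≤m , rest = ih x≤′
                        in k , 1≤k , ℕP.m≤n⇒m≤1+n k≤m , rest

  -- Convex combinations of graphs

  -- These are the folds of `InConvHull`, so its equations apply to them by computation.
  weightedSum : {X : Set} → (X → ℚ) → List (ℚ × X) → ℚ
  weightedSum g = foldr (λ p s → proj₁ p * g (proj₂ p) + s) 0ℚ

  totalWeight : {X : Set} → List (ℚ × X) → ℚ
  totalWeight = foldr (λ p s → proj₁ p + s) 0ℚ

  weightedSum-mono : ∀ {X : Set} {g h : X → ℚ} ws →
    (∀ {w G} → (w , G) ∈ˡ ws → 0ℚ ≤ w) → (∀ G → g G ≤ h G) → weightedSum g ws ≤ weightedSum h ws
  weightedSum-mono []             nonneg g≤h = ℚP.≤-refl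
  weightedSum-mono ((w , G) ∷ ws) nonneg g≤h = ℚP.+-mono-≤
    (ℚP.*-monoˡ-≤-nonNeg w {{ℚ.nonNegative (nonneg (here refl))}} (g≤h G))
    (weightedSum-mono ws (nonneg ∘ there) g≤h)

  weightedSum-affine : ∀ {X : Set} {f} → Affine f → (g : X → ℚ) → ∀ ws → totalWeight ws ≡ 1ℚ →
    weightedSum (f ∘ g) ws ≡ f (weightedSum g ws)
  weightedSum-affine {X} {f} A g ws total = begin
    weightedSum (f ∘ g) ws                    ≡⟨ go ws ⟩
    m * weightedSum g ws + c * totalWeight ws ≡⟨ cong (λ u → m * weightedSum g ws + c * u) total ⟩
    m * weightedSum g ws + c * 1ℚ             ≡⟨ cong (λ u → m * weightedSum g ws + u) (ℚP.*-identityʳ c) ⟩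
    m * weightedSum g ws + c                  ≡⟨ formula A (weightedSum g ws) ⟨
    f (weightedSum g ws)                      ∎
    where
    open ≡-Reasoning
    m = slope A
    c = intercept A
    lem₀ : ∀ m c → 0ℚ ≡ m * 0ℚ + c * 0ℚ
    lem₀ = solve-∀ ring
    lem₁ : ∀ m c w x s u → w * (m * x + c) + (m * s + c * u) ≡ m * (w * x + s) + c * (w + u)
    lem₁ = solve-∀ ring
    go : ∀ ws → weightedSum (f ∘ g) ws ≡ m * weightedSum g ws + c * totalWeight ws
    go []             = lem₀ m c
    go ((w , G) ∷ ws) = trans (cong₂ (λ u v → w * u + v) (formula A (g G)) (go ws))
                              (lem₁ m c w (g G) (weightedSum g ws) (totalWeight ws))

  -- The weights are products: s and r choose points on the segments G₁G₂ and G₃G₄, and t chooses a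
  -- point between those two.
  hull-of-four : ∀ {n} (G₁ G₂ G₃ G₄ : Graph n) {s r t} →
    0ℚ ≤ s → s ≤ 1ℚ → 0ℚ ≤ r → r ≤ 1ℚ → 0ℚ ≤ t → t ≤ 1ℚ →
    let bilerp = λ (g : Graph n → ℚ) → lerp t (lerp s (g G₁) (g G₂)) (lerp r (g G₃) (g G₄)) in
    InConvHull n (bilerp (proj₁ ∘ pt) , bilerp (proj₂ ∘ pt))
  hull-of-four G₁ G₂ G₃ G₄ {s} {r} {t} 0≤s s≤1 0≤r r≤1 0≤t t≤1 =
    ((1ℚ - t) * (1ℚ - s) , G₁) ∷ ((1ℚ - t) * s , G₂) ∷ (t * (1ℚ - r) , G₃) ∷ (t * r , G₄) ∷ []
    , nonneg , total s r t , bilinear (proj₁ ∘ pt) , bilinear (proj₂ ∘ pt)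
    where
    nonneg : ∀ {w G} → (w , G) ∈ˡ _ → 0ℚ ≤ w
    nonneg (here refl)                         = *-nonneg (0≤q-p t≤1) (0≤q-p s≤1)
    nonneg (there (here refl))                 = *-nonneg (0≤q-p t≤1) 0≤s
    nonneg (there (there (here refl)))         = *-nonneg 0≤t (0≤q-p r≤1)
    nonneg (there (there (there (here refl)))) = *-nonneg 0≤t 0≤r
    total : ∀ s r t → (1ℚ - t) * (1ℚ - s) + ((1ℚ - t) * s + (t * (1ℚ - r) + (t * r + 0ℚ))) ≡ 1ℚ
    total = solve-∀ ring
    lem : ∀ s r t a b c d →
      (1ℚ - t) * (1ℚ - s) * a + ((1ℚ - t) * s * b + (t * (1ℚ - r) * c + (t * r * d + 0ℚ)))
        ≡ (1ℚ - t) * ((1ℚ - s) * a + s * b) + t * ((1ℚ - r) * c + r * d)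
    lem = solve-∀ ring
    bilinear : ∀ (g : Graph _ → ℚ) → _
    bilinear g = lem s r t (g G₁) (g G₂) (g G₃) (g G₄)

  -- The lower lines

  lower-affine : ∀ n k → Affine (lowerRHS n k)
  lower-affine n k = record { slope = ℕ→ℚ (2 ^ k ∸ 1) ; intercept = _ ; formula = λ x → ℚP.+-assoc (ℕ→ℚ (2 ^ k ∸ 1) * x) _ (ℕ→ℚ n) }

  -- Subtraction-free form of the value of the k-th lower line at a natural number.
  lower-at : ∀ n k a → lowerRHS n k (ℕ→ℚ a) + ℕ→ℚ (a ℕ.+ 2 ^ k ℕ.* k) ≡ ℕ→ℚ (2 ^ k ℕ.* suc a ℕ.+ n)
  lower-at n k a = begin
    ℕ→ℚ e * ℕ→ℚ a + ℤ→ℚ z + ℕ→ℚ n + ℕ→ℚ (a ℕ.+ 2 ^ k ℕ.* k)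
      ≡⟨ cong (λ u → u + ℤ→ℚ z + ℕ→ℚ n + ℕ→ℚ (a ℕ.+ 2 ^ k ℕ.* k)) (ℕ→ℚ-* e a) ⟨
    ℕ→ℚ (e ℕ.* a) + ℤ→ℚ z + ℕ→ℚ n + ℕ→ℚ (a ℕ.+ 2 ^ k ℕ.* k)
      ≡⟨ trans (ℤ→ℚ-+ (+ (e ℕ.* a) ℤ.+ z ℤ.+ + n) (+ (a ℕ.+ 2 ^ k ℕ.* k)))
           (cong (_+ ℕ→ℚ (a ℕ.+ 2 ^ k ℕ.* k)) (trans (ℤ→ℚ-+ (+ (e ℕ.* a) ℤ.+ z) (+ n))
           (cong (_+ ℕ→ℚ n) (ℤ→ℚ-+ (+ (e ℕ.* a)) z)))) ⟨
    ℤ→ℚ (+ (e ℕ.* a) ℤ.+ z ℤ.+ + n ℤ.+ + (a ℕ.+ 2 ^ k ℕ.* k))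
      ≡⟨ cong ℤ→ℚ integral ⟩
    ℕ→ℚ (2 ^ k ℕ.* suc a ℕ.+ n) ∎
    where
    open ≡-Reasoning
    e = 2 ^ k ∸ 1
    z = + (2 ^ k) ℤ.* (+ 1 ℤ.- + k)
    suc-e : suc e ≡ 2 ^ k
    suc-e = trans (ℕP.+-comm 1 e) (ℕP.m∸n+n≡m (ℕP.m^n>0 2 k))
    lem : ∀ e a k n → e ℤ.* a ℤ.+ (+ 1 ℤ.+ e) ℤ.* (+ 1 ℤ.- k) ℤ.+ n ℤ.+ (a ℤ.+ (+ 1 ℤ.+ e) ℤ.* k)
      ≡ (+ 1 ℤ.+ e) ℤ.* (+ 1 ℤ.+ a) ℤ.+ n
    lem = ℤSolver.solve-∀
    integral : + (e ℕ.* a) ℤ.+ z ℤ.+ + n ℤ.+ + (a ℕ.+ 2 ^ k ℕ.* k) ≡ + (2 ^ k ℕ.* suc a ℕ.+ n)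
    integral = subst
      (λ N → + (e ℕ.* a) ℤ.+ + N ℤ.* (+ 1 ℤ.- + k) ℤ.+ + n ℤ.+ + (a ℕ.+ N ℕ.* k) ≡ + (N ℕ.* suc a ℕ.+ n)) suc-e
      (trans (cong₂ (λ u v → u ℤ.+ + suc e ℤ.* (+ 1 ℤ.- + k) ℤ.+ + n ℤ.+ (+ a ℤ.+ v)) (ℤP.pos-* e a) (ℤP.pos-* (suc e) k))
      (trans (lem (+ e) (+ a) (+ k) (+ n))
             (cong (ℤ._+ + n) (sym (ℤP.pos-* (suc e) (suc a))))))

  lower-≤ : ∀ n k {a y} → 2 ^ k ℕ.* suc a ℕ.+ n ℕ.≤ y ℕ.+ (a ℕ.+ 2 ^ k ℕ.* k) → lowerRHS n k (ℕ→ℚ a) ≤ ℕ→ℚ y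
  lower-≤ n k {a} {y} h = ℚP.≤-trans (ℚP.≤-reflexive (lem (lowerRHS n k (ℕ→ℚ a)) u))
    (ℚP.≤-trans (ℚP.+-monoˡ-≤ (- u) (subst₂ _≤_ (sym (lower-at n k a)) (ℕ→ℚ-+ y _) (ℕ→ℚ-mono-≤ h)))
      (ℚP.≤-reflexive (sym (lem (ℕ→ℚ y) u))))
    where
    u = ℕ→ℚ (a ℕ.+ 2 ^ k ℕ.* k)
    lem : ∀ x u → x ≡ x + u - u
    lem = solve-∀ ring

  lower-≡ : ∀ n k {a y} → y ℕ.+ (a ℕ.+ 2 ^ k ℕ.* k) ≡ 2 ^ k ℕ.* suc a ℕ.+ n → ℕ→ℚ y ≡ lowerRHS n k (ℕ→ℚ a)
  lower-≡ n k {a} {y} h = GroupP.∙-cancelʳ ℚP.+-0-group _ _ _ (trans (sym (ℕ→ℚ-+ y _)) (trans (cong ℕ→ℚ h) (sym (lower-at n k a))))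

  /-*-cancel : ∀ d q .{{_ : ℕ.NonZero q}} → (+ d / q) * ℕ→ℚ q ≡ ℕ→ℚ d
  /-*-cancel d q@(suc q-1) = ℚP.toℚᵘ-injective (begin
    toℚᵘ ((+ d / q) * ℕ→ℚ q)         ≈⟨ ℚP.toℚᵘ-homo-* (+ d / q) (ℕ→ℚ q) ⟩
    toℚᵘ (+ d / q) ℚᵘ.* toℚᵘ (ℕ→ℚ q) ≈⟨ ℚᵘP.*-cong (ℚP.toℚᵘ-fromℚᵘ (mkℚᵘ (+ d) q-1)) (toℚᵘ-ℤ→ℚ (+ q)) ⟩
    mkℚᵘ (+ d) q-1 ℚᵘ.* mkℚᵘ (+ q) 0 ≈⟨ *≡* (trans (ℤP.*-identityʳ _) (cong (λ u → + d ℤ.* + u) (sym (ℕP.*-identityʳ q)))) ⟩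
    mkℚᵘ (+ d) 0                     ≈⟨ toℚᵘ-ℤ→ℚ (+ d) ⟨
    toℚᵘ (ℕ→ℚ d)                     ∎)
    where open import Relation.Binary.Reasoning.Setoid ℚᵘP.≃-setoid

  1+n≤2^n : ∀ n → suc n ℕ.≤ 2 ^ n
  1+n≤2^n zero    = ℕP.≤-refl
  1+n≤2^n (suc n) = ℕP.≤-trans (ℕP.m≤n+m (2 ℕ.+ n) (rise n))
    (ℕP.≤-reflexive (trans (cong (rise n ℕ.+_) (ℕP.+-comm 2 n)) (rise+p+2 n)))

  -- Convexity of 2 ^ a: it lies above its chord between k and k + 1.
  chord-below : ∀ k a → 2 ^ k ℕ.* suc a ℕ.≤ 2 ^ a ℕ.+ 2 ^ k ℕ.* k
  chord-below k a with ℕP.<-≤-connex a k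
  ... | inj₁ a<k = ℕP.≤-trans (ℕP.*-monoʳ-≤ (2 ^ k) a<k) (ℕP.m≤n+m _ (2 ^ a))
  ... | inj₂ k≤a with ℕP.m≤n⇒∃[o]m+o≡n k≤a
  ...   | d , refl = begin
    2 ^ k ℕ.* suc (k ℕ.+ d)         ≡⟨ lem (2 ^ k) k d ⟩
    2 ^ k ℕ.* suc d ℕ.+ 2 ^ k ℕ.* k ≤⟨ ℕP.+-monoˡ-≤ (2 ^ k ℕ.* k) (ℕP.*-monoʳ-≤ (2 ^ k) (1+n≤2^n d)) ⟩
    2 ^ k ℕ.* 2 ^ d ℕ.+ 2 ^ k ℕ.* k ≡⟨ cong (ℕ._+ 2 ^ k ℕ.* k) (ℕP.^-distribˡ-+-* 2 k d) ⟨
    2 ^ (k ℕ.+ d) ℕ.+ 2 ^ k ℕ.* k   ∎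
    where
    open ℕP.≤-Reasoning
    lem : ∀ e k d → e ℕ.* suc (k ℕ.+ d) ≡ e ℕ.* suc d ℕ.+ e ℕ.* k
    lem = ℕSolver.solve-∀

  graph-above-lower : ∀ {n} k (G : Graph n) → lowerRHS n k (ℕ→ℚ (α G)) ≤ ℕ→ℚ (F G)
  graph-above-lower {n} k G = lower-≤ n k {α G} {F G} (begin
    2 ^ k ℕ.* suc a ℕ.+ n       ≤⟨ ℕP.+-monoˡ-≤ n (chord-below k a) ⟩
    2 ^ a ℕ.+ 2 ^ k ℕ.* k ℕ.+ n ≡⟨ lem₁ (2 ^ a) (2 ^ k ℕ.* k) n ⟩
    2 ^ a ℕ.+ n ℕ.+ 2 ^ k ℕ.* k ≤⟨ ℕP.+-monoˡ-≤ (2 ^ k ℕ.* k) (F-lower G) ⟩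
    F G ℕ.+ a ℕ.+ 2 ^ k ℕ.* k   ≡⟨ ℕP.+-assoc (F G) a _ ⟩
    F G ℕ.+ (a ℕ.+ 2 ^ k ℕ.* k) ∎)
    where
    open ℕP.≤-Reasoning
    a = α G
    lem₁ : ∀ x y n → x ℕ.+ y ℕ.+ n ≡ x ℕ.+ n ℕ.+ y
    lem₁ = ℕSolver.solve-∀

  OnGraphOf : ∀ {n} → (ℚ → ℚ) → Graph n → Set
  OnGraphOf f G = ℕ→ℚ (F G) ≡ f (ℕ→ℚ (α G))

  -- The k-th line is the chord of a ↦ 2^a + n - a between k and k + 1, with slope 2^(k+1) - 2^k - 1
  -- = 2^k - 1. This lemma and the next one give its two ends.
  extremal-on-lower : ∀ {n} k (G : Graph n) → Extremal k G → OnGraphOf (lowerRHS n k) G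
  extremal-on-lower {n} k G (refl , F≡) = lower-≡ n k {α G} {F G}
    (trans (sym (ℕP.+-assoc (F G) k _)) (trans (cong (ℕ._+ 2 ^ k ℕ.* k) F≡) (lem (2 ^ k) n k)))
    where
    lem : ∀ e n k → e ℕ.+ n ℕ.+ e ℕ.* k ≡ e ℕ.* suc k ℕ.+ n
    lem = ℕSolver.solve-∀

  extremal-on-previous-lower : ∀ {n} k (G : Graph n) → Extremal (suc k) G → OnGraphOf (lowerRHS n k) G
  extremal-on-previous-lower {n} k G (α≡ , F≡) =
    subst (λ a → ℕ→ℚ (F G) ≡ lowerRHS n k (ℕ→ℚ a)) (sym α≡) (lower-≡ n k {suc k} {F G}
      (trans (sym (ℕP.+-assoc (F G) (suc k) _)) (trans (cong (ℕ._+ 2 ^ k ℕ.* k) F≡) (lem (2 ^ k) n k))))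
    where
    lem : ∀ e n k → 2 ℕ.* e ℕ.+ n ℕ.+ e ℕ.* k ≡ e ℕ.* suc (suc k) ℕ.+ n
    lem = ℕSolver.solve-∀

  -- Divided by p, this and the next inequality compare slopes: `rise p` / p, the upper slope, lies
  -- strictly between 1, that of the first lower line, and 2^p - 1, that of the last.
  p<rise : ∀ {p} → 4 ℕ.≤ p → p ℕ.< rise p
  p<rise 4≤p with ℕP.m≤n⇒∃[o]m+o≡n 4≤p
  ... | q , refl = go q
    where
    go : ∀ q → 4 ℕ.+ q ℕ.< rise (4 ℕ.+ q)
    go zero    = ℕP.m≤m+n 5 21
    go (suc q) = ℕP.+-monoˡ-≤ (5 ℕ.+ q) {1} {2 ℕ.* rise (4 ℕ.+ q)} (ℕP.≤-trans (s≤s z≤n) (ℕP.≤-trans (go q) (ℕP.m≤m+n _ _)))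

  rise<p[2^p∸1] : ∀ {p} → 4 ℕ.≤ p → rise p ℕ.< (2 ^ p ∸ 1) ℕ.* p
  rise<p[2^p∸1] {p} 4≤p = ℕP.+-cancelʳ-< (p ℕ.+ 2) _ _ (begin-strict
    rise p ℕ.+ (p ℕ.+ 2)  ≡⟨ rise+p+2 p ⟩
    2 ℕ.* 2 ^ p           ≡⟨ cong (2 ℕ.*_) (ℕP.m∸n+n≡m (ℕP.m^n>0 2 p)) ⟨
    2 ℕ.* (e ℕ.+ 1)       ≡⟨ ℕP.*-distribˡ-+ 2 e 1 ⟩
    2 ℕ.* e ℕ.+ 2         ≤⟨ ℕP.+-monoˡ-≤ 2 (ℕP.≤-trans (ℕP.*-monoˡ-≤ e 2≤p) (ℕP.≤-reflexive (ℕP.*-comm p e))) ⟩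
    e ℕ.* p ℕ.+ 2         <⟨ ℕP.+-monoʳ-< (e ℕ.* p) (ℕP.m<n+m 2 {p} (ℕP.≤-trans (s≤s z≤n) 4≤p)) ⟩
    e ℕ.* p ℕ.+ (p ℕ.+ 2) ∎)
    where
    open ℕP.≤-Reasoning
    e = 2 ^ p ∸ 1
    2≤p : 2 ℕ.≤ p
    2≤p = ℕP.≤-trans (s≤s (s≤s z≤n)) 4≤p

  hull-between : ∀ {n f g} (G₁ G₂ G₃ G₄ : Graph n) {x y} → Affine f → Affine g →
    OnGraphOf f G₁ → OnGraphOf f G₂ → OnGraphOf g G₃ → OnGraphOf g G₄ →
    x ∈Segment[ ℕ→ℚ (α G₁) , ℕ→ℚ (α G₂) ] → x ∈Segment[ ℕ→ℚ (α G₃) , ℕ→ℚ (α G₄) ] →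
    y ∈Segment[ f x , g x ] → InConvHull n (x , y)
  hull-between {n} G₁ G₂ G₃ G₄ {x} {y} Af Ag on₁ on₂ on₃ on₄
    (s , 0≤s , s≤1 , s≡) (r , 0≤r , r≤1 , r≡) (t , 0≤t , t≤1 , t≡) =
    subst (InConvHull n)
      (cong₂ _,_ (trans (cong₂ (lerp t) s≡ r≡) (lerp-idem t x))
                 (trans (cong₂ (lerp t) (on-line Af G₁ G₂ s on₁ on₂ s≡) (on-line Ag G₃ G₄ r on₃ on₄ r≡)) t≡))
      (hull-of-four G₁ G₂ G₃ G₄ 0≤s s≤1 0≤r r≤1 0≤t t≤1)
    where
    lerp-idem : ∀ t x → (1ℚ - t) * x + t * x ≡ x
    lerp-idem = solve-∀ ring
    on-line : ∀ {h} → Affine h → (G G′ : Graph n) → ∀ u → OnGraphOf h G → OnGraphOf h G′ →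
      lerp u (ℕ→ℚ (α G)) (ℕ→ℚ (α G′)) ≡ x → lerp u (ℕ→ℚ (F G)) (ℕ→ℚ (F G′)) ≡ h x
    on-line {h} Ah G G′ u on on′ u≡ =
      trans (cong₂ (lerp u) on on′) (trans (affine-lerp Ah u (ℕ→ℚ (α G)) (ℕ→ℚ (α G′))) (cong h u≡))

  -- The upper line, the polygon and its facets

  module _ (p : ℕ) (4≤p : 4 ℕ.≤ p) (2≤n : 2 ℕ.≤ suc p) where
    private
      n = suc p
      U = upperRHS n 2≤n
      P = ℕ→ℚ p
      0<p : 0 ℕ.< p
      0<p = ℕP.≤-trans (s≤s z≤n) 4≤p
      instance
        P>0 : ℚ.Positive P
        P>0 = ℕ→ℚ-positive 0<p
        p≢0 : ℕ.NonZero p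
        p≢0 = ℕ.>-nonZero 0<p
      c = + (2 ^ n ∸ n ∸ 1) / p
      rise≡ : 2 ^ n ∸ n ∸ 1 ≡ rise p
      rise≡ = begin
        2 ^ n ∸ n ∸ 1                    ≡⟨ ℕP.∸-+-assoc (2 ^ n) n 1 ⟩
        2 ^ n ∸ (n ℕ.+ 1)                ≡⟨ cong₂ _∸_ (rise+p+2 p) (ℕP.+-suc p 1) ⟨
        rise p ℕ.+ (p ℕ.+ 2) ∸ (p ℕ.+ 2) ≡⟨ ℕP.m+n∸n≡m (rise p) (p ℕ.+ 2) ⟩
        rise p                           ∎
        where open ≡-Reasoning
      cP : c * P ≡ ℕ→ℚ (rise p)
      cP = trans (/-*-cancel (2 ^ n ∸ n ∸ 1) p) (cong ℕ→ℚ rise≡)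

    upper-affine : Affine U
    upper-affine = record { slope = c ; intercept = ℕ→ℚ (n ℕ.+ 1) - c ; formula = λ x → lem c x (ℕ→ℚ (n ℕ.+ 1)) }
      where
      lem : ∀ c x b → c * (x - 1ℚ) + b ≡ c * x + (b - c)
      lem = solve-∀ ring

    -- Multiplication by p = n - 1 clears the denominator of the slope and gives the integral form
    -- used in `F-upper`.
    upper-at : ∀ b → U (ℕ→ℚ (suc b)) * P ≡ ℕ→ℚ (p ℕ.* (p ℕ.+ 2) ℕ.+ rise p ℕ.* b)
    upper-at b = begin
      (c * (ℕ→ℚ (suc b) - 1ℚ) + ℕ→ℚ (n ℕ.+ 1)) * P
        ≡⟨ cong₂ (λ u v → (c * (u - 1ℚ) + ℕ→ℚ v) * P) (ℕ→ℚ-+ 1 b) (sym (ℕP.+-suc p 1)) ⟩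
      (c * ((1ℚ + ℕ→ℚ b) - 1ℚ) + ℕ→ℚ (p ℕ.+ 2)) * P
        ≡⟨ lem c (ℕ→ℚ b) (ℕ→ℚ (p ℕ.+ 2)) P ⟩
      P * ℕ→ℚ (p ℕ.+ 2) + c * P * ℕ→ℚ b
        ≡⟨ cong (λ u → P * ℕ→ℚ (p ℕ.+ 2) + u * ℕ→ℚ b) cP ⟩
      P * ℕ→ℚ (p ℕ.+ 2) + ℕ→ℚ (rise p) * ℕ→ℚ b
        ≡⟨ cong₂ _+_ (ℕ→ℚ-* p (p ℕ.+ 2)) (ℕ→ℚ-* (rise p) b) ⟨
      ℕ→ℚ (p ℕ.* (p ℕ.+ 2)) + ℕ→ℚ (rise p ℕ.* b)
        ≡⟨ ℕ→ℚ-+ (p ℕ.* (p ℕ.+ 2)) (rise p ℕ.* b) ⟨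
      ℕ→ℚ (p ℕ.* (p ℕ.+ 2) ℕ.+ rise p ℕ.* b) ∎
      where
      open ≡-Reasoning
      lem : ∀ c b e P → (c * ((1ℚ + b) - 1ℚ) + e) * P ≡ P * e + c * P * b
      lem = solve-∀ ring

    upper-≤ : ∀ {y a} → 1 ℕ.≤ a → p ℕ.* y ℕ.≤ p ℕ.* (p ℕ.+ 2) ℕ.+ rise p ℕ.* (a ∸ 1) → ℕ→ℚ y ≤ U (ℕ→ℚ a)
    upper-≤ {y} {suc b} _ h = ℚP.*-cancelʳ-≤-pos P (begin
      ℕ→ℚ y * P                              ≡⟨ ℚP.*-comm (ℕ→ℚ y) P ⟩
      P * ℕ→ℚ y                              ≡⟨ ℕ→ℚ-* p y ⟨
      ℕ→ℚ (p ℕ.* y)                          ≤⟨ ℕ→ℚ-mono-≤ h ⟩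
      ℕ→ℚ (p ℕ.* (p ℕ.+ 2) ℕ.+ rise p ℕ.* b) ≡⟨ upper-at b ⟨
      U (ℕ→ℚ (suc b)) * P                    ∎)
      where open ℚP.≤-Reasoning

    graph-below-upper : ∀ (G : Graph n) → ℕ→ℚ (F G) ≤ U (ℕ→ℚ (α G))
    graph-below-upper G = upper-≤ {F G} {α G} (α-positive G) (F-upper G 4≤p)

    upper-≡ : ∀ {y b} → p ℕ.* y ≡ p ℕ.* (p ℕ.+ 2) ℕ.+ rise p ℕ.* b → ℕ→ℚ y ≡ U (ℕ→ℚ (suc b))
    upper-≡ {y} {b} h = ℚP.≤-antisym
      (ℚP.*-cancelʳ-≤-pos P (ℚP.≤-reflexive eq)) (ℚP.*-cancelʳ-≤-pos P (ℚP.≤-reflexive (sym eq)))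
      where
      eq : ℕ→ℚ y * P ≡ U (ℕ→ℚ (suc b)) * P
      eq = trans (ℚP.*-comm (ℕ→ℚ y) P) (trans (sym (ℕ→ℚ-* p y)) (trans (cong ℕ→ℚ h) (sym (upper-at b))))

    complete-on-upper : ∀ (G : Graph n) → Extremal 1 G → OnGraphOf U G
    complete-on-upper G (α≡ , F≡) = subst (λ a → ℕ→ℚ (F G) ≡ U (ℕ→ℚ a)) (sym α≡) (upper-≡ {F G} {0}
      (trans (cong (p ℕ.*_) (ℕP.+-cancelʳ-≡ 1 (F G) (p ℕ.+ 2) (trans F≡ (lem₁ p)))) (lem₂ p (rise p))))
      where
      lem₁ : ∀ p → 2 ℕ.+ suc p ≡ p ℕ.+ 2 ℕ.+ 1
      lem₁ = ℕSolver.solve-∀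
      lem₂ : ∀ p x → p ℕ.* (p ℕ.+ 2) ≡ p ℕ.* (p ℕ.+ 2) ℕ.+ x ℕ.* 0
      lem₂ = ℕSolver.solve-∀

    edgeless-on-upper : ∀ (G : Graph n) → Extremal n G → OnGraphOf U G
    edgeless-on-upper G (α≡ , F≡) = subst (λ a → ℕ→ℚ (F G) ≡ U (ℕ→ℚ a)) (sym α≡) (upper-≡ {F G} {p}
      (trans (cong (p ℕ.*_) (trans (ℕP.+-cancelʳ-≡ n (F G) (2 ^ n) F≡) (sym (rise+p+2 p)))) (lem p (rise p))))
      where
      lem : ∀ p x → p ℕ.* (x ℕ.+ (p ℕ.+ 2)) ≡ p ℕ.* (p ℕ.+ 2) ℕ.+ x ℕ.* p
      lem = ℕSolver.solve-∀

    private
      first-slope : slope (lower-affine n 1) < c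
      first-slope = ℚP.*-cancelʳ-<-nonNeg P {{ℚP.pos⇒nonNeg P}} (begin-strict
        ℕ→ℚ 1 * P    ≡⟨ ℚP.*-identityˡ P ⟩
        P            <⟨ ℕ→ℚ-mono-< (p<rise 4≤p) ⟩
        ℕ→ℚ (rise p) ≡⟨ cP ⟨
        c * P        ∎)
        where
        open ℚP.≤-Reasoning

      last-slope : c < slope (lower-affine n p)
      last-slope = ℚP.*-cancelʳ-<-nonNeg P {{ℚP.pos⇒nonNeg P}} (begin-strict
        c * P                   ≡⟨ cP ⟩
        ℕ→ℚ (rise p)            <⟨ ℕ→ℚ-mono-< (rise<p[2^p∸1] 4≤p) ⟩
        ℕ→ℚ ((2 ^ p ∸ 1) ℕ.* p) ≡⟨ ℕ→ℚ-* (2 ^ p ∸ 1) p ⟩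
        ℕ→ℚ (2 ^ p ∸ 1) * P     ∎)
        where
        open ℚP.≤-Reasoning

    hull⇒polygon : ∀ q → InConvHull n q →
      (∀ k → lowerRHS n k (proj₁ q) ≤ proj₂ q) × (proj₂ q ≤ U (proj₁ q))
    hull⇒polygon (x , y) (ws , nonneg , total , refl , refl) =
        (λ k → subst (_≤ y) (weightedSum-affine (lower-affine n k) (proj₁ ∘ pt) ws total)
                 (weightedSum-mono ws nonneg (graph-above-lower k)))
      , subst (y ≤_) (weightedSum-affine upper-affine (proj₁ ∘ pt) ws total)
          (weightedSum-mono ws nonneg graph-below-upper)

    polygon⇒hull : ∀ {x y} → (∀ k → 1 ℕ.≤ k → k ℕ.≤ p → lowerRHS n k x ≤ y) → y ≤ U x → InConvHull n (x , y)
    polygon⇒hull {x} {y} lower upper =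
      from-ends (extremal ℕP.≤-refl (s≤s z≤n)) (extremal (s≤s z≤n) ℕP.≤-refl)
      where
      Interval : Set
      Interval = ∃[ k ] 1 ℕ.≤ k × k ℕ.≤ p × ℕ→ℚ k ≤ x × x ≤ ℕ→ℚ (suc k)

      interval : ℕ→ℚ 1 ≤ x → x ≤ ℕ→ℚ n → Interval
      interval = subst
        (λ m → ℕ→ℚ 1 ≤ x → x ≤ ℕ→ℚ (suc m) → ∃[ k ] 1 ℕ.≤ k × k ℕ.≤ m × ℕ→ℚ k ≤ x × x ≤ ℕ→ℚ (suc k))
        (ℕP.suc-pred p) (unit-interval (ℕ.pred p))

      -- No defining inequality bounds x directly. The first lower line meets the less flat upper
      -- line at x = 1, and the last lower line, steeper than the upper one, meets it at x = n.
      -- Outside these abscissae a lower line runs above the upper one.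
      x-range : ∀ (K E : Graph n) → Extremal 1 K → Extremal n E → ℕ→ℚ 1 ≤ x × x ≤ ℕ→ℚ n
      x-range K E exK exE =
          subst (λ a → ℕ→ℚ a ≤ x) (proj₁ exK)
            (steeper-upper⇒≥ {lowerRHS n 1} {U} (lower-affine n 1) upper-affine {x} {ℕ→ℚ (α K)}
              (ℚP.≤-trans (lower 1 ℕP.≤-refl 0<p) upper)
              (trans (sym (extremal-on-lower 1 K exK)) (complete-on-upper K exK)) first-slope)
        , subst (λ a → x ≤ ℕ→ℚ a) (proj₁ exE)
            (steeper-lower⇒≤ {lowerRHS n p} {U} (lower-affine n p) upper-affine {x} {ℕ→ℚ (α E)}
              (ℚP.≤-trans (lower p 0<p ℕP.≤-refl) upper)
              (trans (sym (extremal-on-previous-lower p E exE)) (edgeless-on-upper E exE)) last-slope)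

      lerp-extremal : ∀ {i j} (G G′ : Graph n) → Extremal i G → Extremal j G′ →
        ℕ→ℚ i ≤ x → x ≤ ℕ→ℚ j → x ∈Segment[ ℕ→ℚ (α G) , ℕ→ℚ (α G′) ]
      lerp-extremal G G′ (refl , _) (refl , _) = lerp-onto

      from-interval : ∀ {k} (K E G G′ : Graph n) → Extremal 1 K → Extremal n E → Extremal k G → Extremal (suc k) G′ →
        ℕ→ℚ 1 ≤ x × x ≤ ℕ→ℚ n → ℕ→ℚ k ≤ x → x ≤ ℕ→ℚ (suc k) → lowerRHS n k x ≤ y → InConvHull n (x , y)
      from-interval {k} K E G G′ exK exE exG exG′ (1≤x , x≤n) k≤x x≤k+1 L≤y =
        hull-between {n} {lowerRHS n k} {U} G G′ K E {x} {y} (lower-affine n k) upper-affine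
          (extremal-on-lower k G exG) (extremal-on-previous-lower k G′ exG′)
          (complete-on-upper K exK) (edgeless-on-upper E exE)
          (lerp-extremal G G′ exG exG′ k≤x x≤k+1) (lerp-extremal K E exK exE 1≤x x≤n) (lerp-onto L≤y upper)

      from-ends : Σ (Graph n) (Extremal 1) → Σ (Graph n) (Extremal n) → InConvHull n (x , y)
      from-ends (K , exK) (E , exE) =
        let 1≤x , x≤n = x-range K E exK exE
            k , 1≤k , k≤p , k≤x , x≤k+1 = interval 1≤x x≤n
            G , exG = extremal 1≤k (ℕP.m≤n⇒m≤1+n k≤p)
            G′ , exG′ = extremal (s≤s z≤n) (s≤s k≤p)
        in from-interval K E G G′ exK exE exG exG′ (1≤x , x≤n) k≤x x≤k+1 (lower k 1≤k k≤p)

    facet-line : ∀ f {i j} → i ℕ.< j → Σ (Graph n) (Extremal i) → Σ (Graph n) (Extremal j) →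
      (∀ G → Extremal i G → OnGraphOf f G) → (∀ G → Extremal j G → OnGraphOf f G) → FacetLine n f
    facet-line f i<j (G , exG) (G′ , exG′) on on′ =
        G , G′
      , (λ pt≡ → ℚP.<⇒≢ (ℕ→ℚ-mono-< (subst₂ ℕ._<_ (sym (proj₁ exG)) (sym (proj₁ exG′)) i<j)) (cong proj₁ pt≡))
      , on G exG , on′ G′ exG′

    lower-facet : ∀ k → 1 ℕ.≤ k → k ℕ.≤ p → FacetLine n (lowerRHS n k)
    lower-facet k 1≤k k≤p = facet-line (lowerRHS n k) (ℕP.n<1+n k)
      (extremal 1≤k (ℕP.m≤n⇒m≤1+n k≤p)) (extremal (s≤s z≤n) (s≤s k≤p))
      (extremal-on-lower k) (extremal-on-previous-lower k)

    upper-facet : FacetLine n U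
    upper-facet = facet-line U 2≤n (extremal ℕP.≤-refl (s≤s z≤n)) (extremal (s≤s z≤n) ℕP.≤-refl)
      complete-on-upper edgeless-on-upper

open import Defs
open import Data.Nat using (ℕ; suc; s≤s; _≤_; _∸_)
open import Data.Rational using (ℚ)
open import Data.Product using (_×_; _,_)
open import Function.Bundles using (_⇔_; mk⇔)
open Polygon

theorem4 : (n : ℕ) → (h : 5 ≤ n) →
    ((p : ℚ × ℚ) → InConvHull n p ⇔ InPolygon n h p) ×
    ((k : ℕ) → 1 ≤ k → k ≤ n ∸ 1 → FacetLine n (lowerRHS n k)) ×
    FacetLine n (upperRHS n (5≤⇒2≤ h))
theorem4 (suc p) h@(s≤s 4≤p) =
    (λ q → mk⇔ (λ hull → let lower , upper = hull⇒polygon p 4≤p 2≤n q hull in (λ k _ _ → lower k) , upper)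
               (λ (lower , upper) → polygon⇒hull p 4≤p 2≤n lower upper))
  , lower-facet p 4≤p 2≤n
  , upper-facet p 4≤p 2≤n
  where
  2≤n = 5≤⇒2≤ h
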